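{- Let $p$ be a prime. (a) If $p\equiv 1\pmod 4$, then \[ \sum_{j=1}^{p-1} r_2(j)\left( \sigma^{\ast}(p-j)- 4\sigma^{\ast}\!\left(\tfrac{p-j}{2}\right) \right)= p-1. \] (b) If $p\equiv 3\pmod 4$, then \[ \sum_{j=1}^{p-1} r_2(j)\left( \sigma^{\ast}(p-j)-4\sigma^{\ast}\!\left(\tfrac{p-j}{2}\right) \right)= -p -1. \]
   Context: $r_2(n)=\#\{(x_1,x_2)\in\mathbb{Z}^2 : n=x_1^2+x_2^2\}$. The function $\sigma^{\ast}$ is defined on $\mathbb{Q}$ by $\sigma^{\ast}(q)=0$ if $q\notin\mathbb{N}=\{1,2,\dots\}$, and $\sigma^{\ast}(q)=\sum_{d\mid q,\ q/d\text{ odd}} d$ for $q\in\mathbb{N}$. -}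

module Defs where

open import Data.Nat as ℕ using (ℕ; zero; suc; _%_)
open import Data.Nat.DivMod using (_/_)
open import Data.Nat.Divisibility using (_∣?_)
open import Data.Integer as ℤ using (ℤ; +_)
open import Data.Rational as ℚ using (ℚ)
open import Data.Product using (_×_; _,_; proj₁; proj₂)
open import Data.Nat.ListAction using (sum)
open import Data.List using (List; map; length; filter; upTo; concatMap; _++_)
open import Data.Bool using (Bool; true; false; if_then_else_; _∧_)
open import Relation.Nullary.Decidable using (⌊_⌋)

intRange : ℕ → List ℤ
intRange n = map (λ k → ℤ.- (+ k)) (upTo (suc n)) ++ map (λ k → + (suc k)) (upTo n)

sq : ℤ → ℤ
sq x = x ℤ.* x

-- r₂(n) = #{(x₁,x₂) ∈ ℤ² : n = x₁² + x₂²}.  Every solution has |xᵢ| ≤ n,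
-- so it suffices to count the pairs in [-n,n]².
r₂ : ℕ → ℕ
r₂ n = length (filter (λ xy → (+ n) ℤ.≟ (sq (proj₁ xy) ℤ.+ sq (proj₂ xy)))
                      (concatMap (λ x → map (λ y → x , y) (intRange n)) (intRange n)))

isOdd : ℕ → Bool
isOdd k = ⌊ k % 2 ℕ.≟ 1 ⌋

-- σ* on ℕ-values: σ*(0) = 0 (0 ∉ ℕ = {1,2,…}); for q ≥ 1,
-- σ*(q) = Σ_{d ∣ q, q/d odd} d, summing over the candidates d = 1,…,q.
σ*ℕ : ℕ → ℕ
σ*ℕ zero = 0
σ*ℕ (suc m) = sum (map term (upTo (suc m)))
  where
  term : ℕ → ℕ
  term e = if ⌊ suc e ∣? suc m ⌋ ∧ isOdd (suc m / suc e) then suc e else 0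

-- σ* on ℚ: 0 unless q is a positive integer (denominator 1, numerator > 0).
σ* : ℚ → ℕ
σ* q with ℚ.numerator q | ℚ.denominatorℕ q
... | + n | 1 = σ*ℕ n
... | _   | _ = 0

sumFrom1 : ℕ → (ℕ → ℤ) → ℤ
sumFrom1 m f = Data.List.foldr ℤ._+_ (+ 0) (map (λ k → f (suc k)) (upTo m))
  where import Data.List

{-# OPTIONS --safe #-}

-- Let S be the set of integer solutions (y, i, d, e) of y² + i² + de = p with d, e > 0 and e odd,
-- and put ε(d) = 1 for odd and -1 for even d.  Since σ*(m) - 4σ*(m/2) is the sum of ε(d) d over
-- m = de with e odd, the sum of r₂(j) (σ*(p-j) - 4σ*((p-j)/2)) over 0 ≤ j < p is the sum of
-- ε(d) d over S.  Liouville's method evaluates it: reflecting (i, d, e) to (e - i, d + 2i - e, e)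
-- where d + 2i > e, mapping it to (i + d, e - 2i - d, d) where d + 2i < e, and exchanging d and e,
-- everything cancels except the sum of d over the solutions with d + 2i = e.  For these
-- y² + (e - i)² = p, and each (y, s) with s > 0 and y² + s² = p contributes the sum of the first
-- s odd numbers, s².  So the total is 0 if p ≡ 3 (mod 4), and 2p if p ≡ 1 (mod 4), by the existence
-- (Heath-Brown) and uniqueness of p = a² + b².  The term j = 0 is σ*(p) = p + 1.
module Submission where

open import Defs
open import Algebra.Bundles using (AbelianGroup)
open import Data.Bool using (Bool; true; false; if_then_else_; _∧_)
import Data.Bool.Properties as Bool
open import Data.Empty using (⊥; ⊥-elim)
open import Data.Integer as ℤ using (ℤ; +_; -[1+_]; ∣_∣; 0ℤ; 1ℤ; _+_; _*_; _-_; -_; _<_)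
import Data.Integer.Divisibility.Signed as ℤ
import Data.Integer.Properties as ℤ
open import Data.Integer.Tactic.RingSolver using (solve-∀)
open import Data.List using (List; []; _∷_; _++_; map; filter; foldr; concatMap; length; upTo; applyUpTo; cartesianProduct)
open import Data.List.Membership.Propositional using (_∈_; find; lose)
open import Data.List.Membership.Propositional.Properties
  using (∈-filter⁺; ∈-filter⁻; ∈-map⁺; ∈-map⁻; ∈-concatMap⁺; ∈-concatMap⁻; ∈-upTo⁺; ∈-upTo⁻;
         ∈-++⁺ˡ; ∈-++⁺ʳ; ∈-++⁻; ∈-cartesianProduct⁺; ∈-cartesianProduct⁻)
open import Data.List.Membership.Propositional.Properties.WithK using (unique∧set⇒bag)
open import Data.List.Properties using (map-upTo)
open import Data.List.Relation.Binary.BagAndSetEquality using (∼bag⇒↭)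
open import Data.List.Relation.Binary.Permutation.Propositional using (_↭_; ↭⇒↭ₛ)
open import Data.List.Relation.Binary.Permutation.Propositional.Properties using (map⁺)
open import Data.List.Relation.Unary.All as All using ()
open import Data.List.Relation.Unary.AllPairs using ([]; _∷_)
open import Data.List.Relation.Unary.Any using (here; there)
open import Data.List.Relation.Unary.Unique.Propositional using (Unique)
import Data.List.Relation.Unary.Unique.Propositional.Properties as Unique
open import Data.Nat as ℕ using (ℕ; zero; suc; _∸_; _%_; parity)
open import Data.Nat.Coprimality as Coprime using (Coprime; 1-coprimeTo)
import Data.Nat.DivMod as ℕ
import Data.Nat.Divisibility as ℕ
open import Data.Nat.Divisibility using (divides)
open import Data.Nat.ListAction using (sum)
open import Data.Nat.Primality
  using (Prime; prime⇒irreducible; prime⇒nonZero; euclidsLemma; irreducible[2]; ¬prime[1])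
import Data.Nat.Properties as ℕ
open import Data.Parity as ℙ using (Parity; 0ℙ; 1ℙ)
import Data.Parity.Properties as ℙ
open import Data.Product using (∃; _×_; _,_; proj₁; proj₂)
open import Data.Rational as ℚ using ()
import Data.Rational.Properties as ℚ
open import Data.Rational.Unnormalised using (mkℚᵘ; *≡*)
open import Data.Sum as Sum using (_⊎_; inj₁; inj₂)
open import Function using (_∘_; id; mk⇔)
open import Relation.Binary.PropositionalEquality
  using (_≡_; _≢_; refl; sym; trans; cong; cong₂; subst; subst₂; module ≡-Reasoning)
open import Relation.Nullary using (¬_; Dec; yes; no)
open import Relation.Nullary.Decidable using (¬?; _×-dec_; ⌊_⌋)
open import Relation.Unary using (Decidable)
open import Algebra.Properties.Group (AbelianGroup.group ℤ.+-0-abelianGroup)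
  using () renaming (∙-cancelˡ to +-cancelˡ-≡; ∙-cancelʳ to +-cancelʳ-≡)
open import Data.List.Relation.Binary.Permutation.Setoid.Properties (ℤ.≡-setoid) using (foldr-commMonoid)

-- The weight carried through the maps is e - 2i, not d. Its sum over S is the sum of e, because i
-- and -i occur symmetrically. It changes sign under the reflection, equals d on the diagonal, and
-- where d + 2i < e it is (e - 2i - d) + d, the sum of the two new cofactors. The obstacle is that
-- the last coordinate must stay odd. The map to (i + d, e - 2i - d, d) puts d there, so it serves
-- only odd d; for even d the two new cofactors are exchanged and i + d is negated. In both cases
-- the third coordinate of the image is even, and the two images together cover each solution with
-- even d exactly once. This is the origin of the sign ε: a solution with even d counts as e in the
-- first evaluation and as d + e in the second, which leaves -d, while among the solutions with odd
-- d the exchange of d and e turns the sum of e into the sum of d.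

private variable
  A B : Set
  P Q : A → Set
  xs ys : List A

-- Sums over finite sets

-- A finite set is represented by any duplicate-free enumeration of a predicate. A sum then depends
-- on the predicate alone, and a change of variables only has to be checked on predicates.
record _Lists_ {A : Set} (xs : List A) (P : A → Set) : Set where
  field
    unique   : Unique xs
    sound    : ∀ {t} → t ∈ xs → P t
    complete : ∀ {t} → P t → t ∈ xs
open _Lists_

-- Shaped like `sumFrom1`, so that `sumFrom1 m f` is definitionally `∑ (upTo m) (f ∘ suc)`.
∑ : List A → (A → ℤ) → ℤ
∑ xs w = foldr _+_ (+ 0) (map w xs)

∑-cong : ∀ (xs : List A) {v w : A → ℤ} → (∀ {t} → t ∈ xs → v t ≡ w t) → ∑ xs v ≡ ∑ xs w
∑-cong []       v≗w = refl
∑-cong (x ∷ xs) v≗w = cong₂ _+_ (v≗w (here refl)) (∑-cong xs (v≗w ∘ there))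

∑-+ : ∀ (xs : List A) (v w : A → ℤ) → ∑ xs (λ t → v t + w t) ≡ ∑ xs v + ∑ xs w
∑-+ []       v w = refl
∑-+ (x ∷ xs) v w = trans (cong (_+_ (v x + w x)) (∑-+ xs v w)) (interchange (v x) (w x) (∑ xs v) (∑ xs w))
  where
  interchange : ∀ a b c d → a + b + (c + d) ≡ a + c + (b + d)
  interchange = solve-∀

∑-* : ∀ c (xs : List A) (w : A → ℤ) → ∑ xs (λ t → c * w t) ≡ c * ∑ xs w
∑-* c []       w = sym (ℤ.*-zeroʳ c)
∑-* c (x ∷ xs) w = trans (cong (_+_ (c * w x)) (∑-* c xs w)) (sym (ℤ.*-distribˡ-+ c (w x) (∑ xs w)))

∑-neg : ∀ (xs : List A) (w : A → ℤ) → ∑ xs (λ t → - w t) ≡ - ∑ xs w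
∑-neg []       w = refl
∑-neg (x ∷ xs) w = trans (cong (_+_ (- w x)) (∑-neg xs w)) (sym (ℤ.neg-distrib-+ (w x) (∑ xs w)))

∑-split : {R : A → Set} (R? : Decidable R) (xs : List A) (w : A → ℤ) →
          ∑ xs w ≡ ∑ (filter R? xs) w + ∑ (filter (¬? ∘ R?) xs) w
∑-split R? []       w = refl
∑-split R? (x ∷ xs) w with R? x
... | yes _ = trans (cong (_+_ (w x)) (∑-split R? xs w)) (sym (ℤ.+-assoc (w x) _ _))
... | no  _ = trans (cong (_+_ (w x)) (∑-split R? xs w)) (swap (w x) (∑ (filter R? xs) w) (∑ (filter (¬? ∘ R?) xs) w))
  where
  swap : ∀ a b c → a + (b + c) ≡ b + (a + c)
  swap = solve-∀

∑-↭ : ∀ (w : A → ℤ) → xs ↭ ys → ∑ xs w ≡ ∑ ys w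
∑-↭ w p = foldr-commMonoid ℤ.+-0-isCommutativeMonoid (↭⇒↭ₛ (map⁺ w p))

-- Without duplicates, having the same members means being the same bag, hence being permutations of
-- each other.
∑-Lists : xs Lists P → ys Lists P → ∀ w → ∑ xs w ≡ ∑ ys w
∑-Lists xsP ysP w = ∑-↭ w (∼bag⇒↭ (unique∧set⇒bag (unique xsP) (unique ysP)
  (mk⇔ (complete ysP ∘ sound xsP) (complete xsP ∘ sound ysP))))

Lists-resp : (∀ {t} → P t → Q t) → (∀ {t} → Q t → P t) → xs Lists P → xs Lists Q
Lists-resp P⇒Q Q⇒P l = record
  { unique = unique l ; sound = P⇒Q ∘ sound l ; complete = complete l ∘ Q⇒P }

filter-Lists : {R : A → Set} (R? : Decidable R) → xs Lists P → filter R? xs Lists (λ t → P t × R t)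
filter-Lists {xs = xs} R? l = record
  { unique   = Unique.filter⁺ R? (unique l)
  ; sound    = λ t∈ → let t∈xs , r = ∈-filter⁻ R? {xs = xs} t∈ in sound l t∈xs , r
  ; complete = λ (p , r) → ∈-filter⁺ R? (complete l p) r
  }

-- The inverse laws are stated on the whole types: the maps this is applied to are integral linear
-- substitutions or regroupings of coordinates, invertible everywhere, so that the laws are ring
-- identities free of side conditions.
map-Lists : (φ : A → B) (ψ : B → A) → (∀ t → ψ (φ t) ≡ t) → (∀ t → φ (ψ t) ≡ t) →
            (∀ t → P t → Q (φ t)) → (∀ t → Q t → P (ψ t)) → xs Lists P → map φ xs Lists Q
map-Lists {Q = Q} {xs = xs} φ ψ ψφ φψ P⇒Q Q⇒P l = record
  { unique   = Unique.map⁺ (λ {x} {y} eq → trans (sym (ψφ x)) (trans (cong ψ eq) (ψφ y))) (unique l)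
  ; sound    = λ t∈ → let _ , s∈ , eq = ∈-map⁻ φ t∈ in subst Q (sym eq) (P⇒Q _ (sound l s∈))
  ; complete = λ {t} q → subst (_∈ map φ xs) (φψ t) (∈-map⁺ φ (complete l (Q⇒P _ q)))
  }

∑-map : ∀ (φ : A → B) (xs : List A) w → ∑ (map φ xs) w ≡ ∑ xs (w ∘ φ)
∑-map φ []       w = refl
∑-map φ (x ∷ xs) w = cong (_+_ (w (φ x))) (∑-map φ xs w)

∑-bij : ∀ {v w} → xs Lists P → ys Lists Q → (φ : A → B) (ψ : B → A) →
        (∀ t → ψ (φ t) ≡ t) → (∀ t → φ (ψ t) ≡ t) →
        (∀ t → P t → Q (φ t)) → (∀ t → Q t → P (ψ t)) →
        (∀ t → v t ≡ w (φ t)) → ∑ xs v ≡ ∑ ys w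
∑-bij {xs = xs} {w = w} xsP ysQ φ ψ ψφ φψ P⇒Q Q⇒P v≗w∘φ =
  trans (∑-cong xs (λ {t} _ → v≗w∘φ t))
    (trans (sym (∑-map φ xs w))
      (∑-Lists (map-Lists φ ψ ψφ φψ P⇒Q Q⇒P xsP) ysQ w))

∑-none : (∀ {t} → t ∈ xs → P t) → (∀ {t} → ¬ P t) → ∀ w → ∑ xs w ≡ 0ℤ
∑-none {xs = []}     _     _  w = refl
∑-none {xs = x ∷ xs} sound ¬P w = ⊥-elim (¬P (sound (here refl)))

∑-++ : ∀ (xs ys : List A) w → ∑ (xs ++ ys) w ≡ ∑ xs w + ∑ ys w
∑-++ []       ys w = sym (ℤ.+-identityˡ _)
∑-++ (x ∷ xs) ys w = trans (cong (_+_ (w x)) (∑-++ xs ys w)) (sym (ℤ.+-assoc (w x) _ _))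

∑-concatMap : ∀ (F : B → List A) ks w → ∑ (concatMap F ks) w ≡ ∑ ks (λ j → ∑ (F j) w)
∑-concatMap F []       w = refl
∑-concatMap F (k ∷ ks) w = trans (∑-++ (F k) _ w) (cong (_+_ (∑ (F k) w)) (∑-concatMap F ks w))

-- K is the graph of a function, and F j lists its fibre over j.
concatMap-Lists : ∀ {js : List B} {F : B → List A} (K : A → B → Set) →
  (∀ {t i j} → K t i → K t j → i ≡ j) → js Lists Q →
  (∀ {t} → P t → ∃ λ j → Q j × K t j) →
  (∀ {j} → Q j → F j Lists (λ t → P t × K t j)) →
  concatMap F js Lists P
concatMap-Lists {Q = Q} {js = js} {F} K functional js-l key F-l = record
  { unique   = cat-unique (unique js-l) (sound js-l)
  ; sound    = λ t∈ → let j , j∈ , t∈j = find (∈-concatMap⁻ F t∈) in proj₁ (sound (F-l (sound js-l j∈)) t∈j)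
  ; complete = λ p → let j , q , k = key p in
                     ∈-concatMap⁺ F (lose (complete js-l q) (complete (F-l q) (p , k)))
  }
  where
  cat-unique : ∀ {ks} → Unique ks → (∀ {k} → k ∈ ks → Q k) → Unique (concatMap F ks)
  cat-unique []            _ = []
  cat-unique (k∉ks ∷ ks-u) q = Unique.++⁺ (unique (F-l (q (here refl)))) (cat-unique ks-u (q ∘ there))
    λ (t∈₁ , t∈₂) → let j , j∈ , t∈j = find (∈-concatMap⁻ F t∈₂) in
      All.lookup k∉ks j∈ (functional (proj₂ (sound (F-l (q (here refl))) t∈₁))
                                      (proj₂ (sound (F-l (q (there j∈))) t∈j)))

-- Parity and Liouville's identity

⁻¹-cancel : ∀ p q → p ℙ.+ q ≡ (p ℙ.⁻¹) ℙ.+ (q ℙ.⁻¹)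
⁻¹-cancel 0ℙ 0ℙ = refl
⁻¹-cancel 0ℙ 1ℙ = refl
⁻¹-cancel 1ℙ 0ℙ = refl
⁻¹-cancel 1ℙ 1ℙ = refl

parity-suc : ∀ k → parity (suc k) ≡ parity k ℙ.⁻¹
parity-suc k = sym (ℙ.⁻¹-selfInverse (ℙ.suc-homo-⁻¹ k))

par : ℤ → Parity
par z = parity ∣ z ∣

par-⊖ : ∀ m n → par (m ℤ.⊖ n) ≡ parity m ℙ.+ parity n
par-⊖ zero    zero    = refl
par-⊖ zero    (suc n) = refl
par-⊖ (suc m) zero    = sym (ℙ.+-identityʳ _)
par-⊖ (suc m) (suc n) = begin
  par (suc m ℤ.⊖ suc n)                   ≡⟨ cong par (ℤ.[1+m]⊖[1+n]≡m⊖n m n) ⟩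
  par (m ℤ.⊖ n)                           ≡⟨ par-⊖ m n ⟩
  parity m ℙ.+ parity n                   ≡⟨ ⁻¹-cancel (parity m) (parity n) ⟩
  (parity m ℙ.⁻¹) ℙ.+ (parity n ℙ.⁻¹)     ≡⟨ cong₂ ℙ._+_ (sym (parity-suc m)) (sym (parity-suc n)) ⟩
  parity (suc m) ℙ.+ parity (suc n)       ∎
  where
  open ≡-Reasoning

par-+ : ∀ i j → par (i + j) ≡ par i ℙ.+ par j
par-+ (+ m)    (+ n)    = ℙ.+-homo-+ m n
par-+ (+ m)    -[1+ n ] = par-⊖ m (suc n)
par-+ -[1+ m ] (+ n)    = trans (par-⊖ n (suc m)) (ℙ.+-comm (parity n) (parity (suc m)))
par-+ -[1+ m ] -[1+ n ] = begin
  parity (m ℕ.+ n)                        ≡⟨ ℙ.+-homo-+ m n ⟩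
  parity m ℙ.+ parity n                   ≡⟨ ⁻¹-cancel (parity m) (parity n) ⟩
  (parity m ℙ.⁻¹) ℙ.+ (parity n ℙ.⁻¹)     ≡⟨ cong₂ ℙ._+_ (sym (parity-suc m)) (sym (parity-suc n)) ⟩
  parity (suc m) ℙ.+ parity (suc n)       ∎
  where open ≡-Reasoning

par-neg : ∀ i → par (- i) ≡ par i
par-neg i = cong parity (ℤ.∣-i∣≡∣i∣ i)

par-- : ∀ i j → par (i - j) ≡ par i ℙ.+ par j
par-- i j = trans (par-+ i (- j)) (cong (par i ℙ.+_) (par-neg j))

par-* : ∀ i j → par (i * j) ≡ par i ℙ.* par j
par-* i j = trans (cong parity (ℤ.abs-* i j)) (ℙ.*-homo-* ∣ i ∣ ∣ j ∣)

-- This is how sums are shown to vanish: an involution that reverses the weight makes the sum equal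
-- to its own negative.
i≡-i⇒i≡0 : ∀ {i} → i ≡ - i → i ≡ 0ℤ
i≡-i⇒i≡0 {+ zero} eq = refl

-- sgn (par d) * d is the contribution of d to σ*(m) - 4 σ*(m/2) when m = d e with e odd.
sgn : Parity → ℤ
sgn 1ℙ = 1ℤ
sgn 0ℙ = - 1ℤ

module Liouville (n : ℤ) where

  Quad : Set
  Quad = ℤ × ℤ × ℤ × ℤ

  quad≡ : ∀ {y i i′ d d′ e e′ : ℤ} → i ≡ i′ → d ≡ d′ → e ≡ e′ → (y , i , d , e) ≡ (y , i′ , d′ , e′)
  quad≡ refl refl refl = refl

  Eqn Sol : Quad → Set
  Eqn (y , i , d , e) = y * y + i * i + d * e ≡ n
  Sol t@(_ , _ , d , e) = Eqn t × 0ℤ < d × 0ℤ < e × par e ≡ 1ℙ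

  -- `X` is the weight to be summed in two ways. `L` is the third coordinate after the reflection;
  -- its sign decides which map applies to a solution.
  I D E X L : Quad → ℤ
  I (_ , i , _ , _) = i
  D (_ , _ , d , _) = d
  E (_ , _ , _ , e) = e
  X (_ , i , d , e) = e - + 2 * i
  L (_ , i , d , e) = d + + 2 * i - e

  Pos Diag OddD : Quad → Set
  Pos t  = 0ℤ < L t
  Diag t = L t ≡ 0ℤ
  OddD t = par (D t) ≡ 1ℙ

  pos?  : Decidable Pos
  pos? t = 0ℤ ℤ.<? L t
  diag? : Decidable Diag
  diag? t = L t ℤ.≟ 0ℤ
  oddD? : Decidable OddD
  oddD? t = par (D t) ℙ.≟ 1ℙ

  par2* : ∀ i → par (+ 2 * i) ≡ 0ℙ
  par2* i = par-* (+ 2) i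

  module _ {S : List Quad} (S-l : S Lists Sol) where

    ∑X≡∑E : ∑ S X ≡ ∑ S E
    ∑X≡∑E = begin
      ∑ S X                                ≡⟨ ∑-cong S (λ {t} _ → shape (E t) (I t)) ⟩
      ∑ S (λ t → E t + - + 2 * I t)        ≡⟨ ∑-+ S E (λ t → - + 2 * I t) ⟩
      ∑ S E + ∑ S (λ t → - + 2 * I t)      ≡⟨ cong (_+_ (∑ S E)) (∑-* (- + 2) S I) ⟩
      ∑ S E + - + 2 * ∑ S I                ≡⟨ cong (λ z → ∑ S E + - + 2 * z) ∑I≡0 ⟩
      ∑ S E + - + 2 * 0ℤ                   ≡⟨ ℤ.+-identityʳ (∑ S E) ⟩
      ∑ S E                                ∎
      where
      open ≡-Reasoning
      shape : ∀ e i → e - + 2 * i ≡ e + - + 2 * i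
      shape = solve-∀
      φ : Quad → Quad
      φ (y , i , d , e) = y , - i , d , e
      φφ : ∀ t → φ (φ t) ≡ t
      φφ (y , i , d , e) = quad≡ (ℤ.neg-involutive i) refl refl
      φ-Sol : ∀ t → Sol t → Sol (φ t)
      φ-Sol (y , i , d , e) (eq , rest) = trans (alg y i d e) eq , rest
        where
        alg : ∀ y i d e → y * y + (- i) * (- i) + d * e ≡ y * y + i * i + d * e
        alg = solve-∀
      ∑I≡0 : ∑ S I ≡ 0ℤ
      ∑I≡0 = i≡-i⇒i≡0 (trans (∑-bij {w = λ t → - I t} S-l S-l φ φ φφ φφ φ-Sol φ-Sol
                                     (λ t → sym (ℤ.neg-involutive (I t))))
                             (∑-neg S I))

    S₊ S₋₀ S₀ S₋ S₁ S₂ : List Quad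
    S₊  = filter pos? S
    S₋₀ = filter (¬? ∘ pos?) S
    S₀  = filter diag? S₋₀
    S₋  = filter (¬? ∘ diag?) S₋₀
    S₁  = filter oddD? S
    S₂  = filter (¬? ∘ oddD?) S

    S₊-l = filter-Lists pos? S-l
    S₋-l = filter-Lists (¬? ∘ diag?) (filter-Lists (¬? ∘ pos?) S-l)
    S₁-l = filter-Lists oddD? S-l
    S₂-l = filter-Lists (¬? ∘ oddD?) S-l

    -- The reflection exchanges the values of `D` and `L` and fixes `E`. Both are positive on `S₊`,
    -- so it is an involution there, and it reverses `X`.
    ∑X₊≡0 : ∑ S₊ X ≡ 0ℤ
    ∑X₊≡0 = i≡-i⇒i≡0 (trans (∑-bij {w = λ t → - X t} S₊-l S₊-l φ φ φφ φφ φ-Sol φ-Sol X-odd) (∑-neg S₊ X))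
      where
      φ : Quad → Quad
      φ (y , i , d , e) = y , e - i , d + + 2 * i - e , e
      φφ : ∀ t → φ (φ t) ≡ t
      φφ (y , i , d , e) = quad≡ (a i e) (b i d e) refl
        where
        a : ∀ i e → e - (e - i) ≡ i
        a = solve-∀
        b : ∀ i d e → (d + + 2 * i - e) + + 2 * (e - i) - e ≡ d
        b = solve-∀
      X-odd : ∀ t → X t ≡ - X (φ t)
      X-odd (y , i , d , e) = a i e
        where
        a : ∀ i e → e - + 2 * i ≡ - (e - + 2 * (e - i))
        a = solve-∀
      φ-Sol : ∀ t → Sol t × Pos t → Sol (φ t) × Pos (φ t)
      φ-Sol (y , i , d , e) ((eq , d>0 , e>0 , odd) , pos) =
        (trans (a y i d e) eq , pos , e>0 , odd) , subst (0ℤ <_) (b i d e) d>0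
        where
        a : ∀ y i d e → y * y + (e - i) * (e - i) + (d + + 2 * i - e) * e ≡ y * y + i * i + d * e
        a = solve-∀
        b : ∀ i d e → d ≡ (d + + 2 * i - e) + + 2 * (e - i) - e
        b = solve-∀

    ∑X₀≡∑D₀ : ∑ S₀ X ≡ ∑ S₀ D
    ∑X₀≡∑D₀ = ∑-cong S₀ λ {t} t∈ → diag⇒ t (proj₂ (∈-filter⁻ diag? {xs = S₋₀} t∈))
      where
      diag⇒ : ∀ t → Diag t → X t ≡ D t
      diag⇒ (y , i , d , e) diag = begin
        e - + 2 * i                        ≡⟨ a i d e ⟩
        d - (d + + 2 * i - e)              ≡⟨ cong (λ z → d - z) diag ⟩
        d - 0ℤ                             ≡⟨ ℤ.+-identityʳ d ⟩
        d                                  ∎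
        where
        open ≡-Reasoning
        a : ∀ i d e → e - + 2 * i ≡ d - (d + + 2 * i - e)
        a = solve-∀

    even-D : ∀ t → ¬ OddD t → par (D t) ≡ 0ℙ
    even-D t ¬odd with par (D t)
    ... | 0ℙ = refl
    ... | 1ℙ = ⊥-elim (¬odd refl)

    -- The maps on `S₋` create the coordinate e - 2i - d. As e is odd, its parity is opposite to
    -- that of d, which tells whether it may stand in the odd last place.
    par-E-2I-D : ∀ t → Sol t → par (E t - + 2 * I t - D t) ≡ par (D t) ℙ.⁻¹
    par-E-2I-D (y , i , d , e) (_ , _ , _ , odd) = begin
      par (e - + 2 * i - d)                      ≡⟨ par-- (e - + 2 * i) d ⟩
      par (e - + 2 * i) ℙ.+ par d                ≡⟨ cong (ℙ._+ par d) (par-- e (+ 2 * i)) ⟩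
      par e ℙ.+ par (+ 2 * i) ℙ.+ par d          ≡⟨ cong₂ (λ x z → x ℙ.+ z ℙ.+ par d) odd (par2* i) ⟩
      par d ℙ.⁻¹                                 ∎
      where open ≡-Reasoning

    even⇒ : ∀ t → par (D t) ≡ 0ℙ → ¬ OddD t
    even⇒ t even odd with () ← trans (sym even) odd

    par-L : ∀ t → Sol t → par (L t) ≡ par (D t) ℙ.⁻¹
    par-L t@(y , i , d , e) sol = trans (sym (par-neg (L t))) (trans (cong par (a i d e)) (par-E-2I-D t sol))
      where
      a : ∀ i d e → - (d + + 2 * i - e) ≡ e - + 2 * i - d
      a = solve-∀

    -- Serves the maps into `S₋`: there `L` of the image is -d or -e for a positive coordinate d or
    -- e of the source, which excludes `Pos` and `Diag` at once.
    -e<0 : ∀ {e l} → 0ℤ < e → - e ≡ l → ¬ 0ℤ < l × l ≢ 0ℤ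
    -e<0 {e} e>0 refl = ℤ.<-asym -e<0′ , ℤ.<⇒≢ -e<0′
      where
      -e<0′ : - e < 0ℤ
      -e<0′ = ℤ.neg-mono-< e>0

    neg⇒ : ∀ t → ¬ Pos t → ¬ Diag t → 0ℤ < E t - + 2 * I t - D t
    neg⇒ t@(y , i , d , e) ¬pos ¬diag = subst (0ℤ <_) (a i d e)
      (ℤ.neg-mono-< (ℤ.≤∧≢⇒< (ℤ.≮⇒≥ ¬pos) ¬diag))
      where
      a : ∀ i d e → - (d + + 2 * i - e) ≡ e - + 2 * i - d
      a = solve-∀

    -- Half of S₋ lands in the half Pos of S₂, the other half in the complement.
    ∑X₋≡∑D₂+∑E₂ : ∑ S₋ X ≡ ∑ S₂ D + ∑ S₂ E
    ∑X₋≡∑D₂+∑E₂ = begin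
      ∑ S₋ X
        ≡⟨ ∑-split oddD? S₋ X ⟩
      ∑ (filter oddD? S₋) X + ∑ (filter (¬? ∘ oddD?) S₋) X
        ≡⟨ cong₂ _+_
             (∑-bij {w = DE} (filter-Lists oddD? S₋-l) (filter-Lists pos? S₂-l) φ φ⁻¹ φ⁻¹φ φφ⁻¹ φ-Old φ⁻¹-New X≗φ)
             (∑-bij {w = DE} (filter-Lists (¬? ∘ oddD?) S₋-l) (filter-Lists (¬? ∘ pos?) S₂-l) χ χ χχ χχ χ-Old χ-New X≗χ) ⟩
      ∑ (filter pos? S₂) DE + ∑ (filter (¬? ∘ pos?) S₂) DE
        ≡⟨ ∑-split pos? S₂ DE ⟨
      ∑ S₂ DE
        ≡⟨ ∑-+ S₂ D E ⟩
      ∑ S₂ D + ∑ S₂ E ∎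
      where
      open ≡-Reasoning
      DE : Quad → ℤ
      DE t = D t + E t
      Old New : Quad → Set
      Old t = (Sol t × ¬ Pos t) × ¬ Diag t
      New t = Sol t × ¬ OddD t
      -- Both maps split `X` into the new cofactors e - 2i - d and d, and put the odd one last: that
      -- is d in `φ`, used for odd d, and e - 2i - d in `χ`, used for even d. `L` becomes e under
      -- `φ` and -e under `χ`, so the images are separated by `Pos`; the negation of i + d in `χ`
      -- achieves this.
      φ φ⁻¹ χ : Quad → Quad
      φ   (y , i , d , e) = y , i + d , e - + 2 * i - d , d
      φ⁻¹ (y , i , d , e) = y , i - e , e , d + + 2 * i - e
      χ   (y , i , d , e) = y , - i - d , d , e - + 2 * i - d
      φ⁻¹φ : ∀ t → φ⁻¹ (φ t) ≡ t
      φ⁻¹φ (y , i , d , e) = quad≡ (a i d) refl (b i d e)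
        where
        a : ∀ i d → i + d - d ≡ i
        a = solve-∀
        b : ∀ i d e → (e - + 2 * i - d) + + 2 * (i + d) - d ≡ e
        b = solve-∀
      φφ⁻¹ : ∀ t → φ (φ⁻¹ t) ≡ t
      φφ⁻¹ (y , i , d , e) = quad≡ (a i e) (b i d e) refl
        where
        a : ∀ i e → i - e + e ≡ i
        a = solve-∀
        b : ∀ i d e → (d + + 2 * i - e) - + 2 * (i - e) - e ≡ d
        b = solve-∀
      χχ : ∀ t → χ (χ t) ≡ t
      χχ (y , i , d , e) = quad≡ (a i d) refl (b i d e)
        where
        a : ∀ i d → - (- i - d) - d ≡ i
        a = solve-∀
        b : ∀ i d e → (e - + 2 * i - d) - + 2 * (- i - d) - d ≡ e
        b = solve-∀
      X≗φ : ∀ t → X t ≡ DE (φ t)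
      X≗φ (y , i , d , e) = a i d e
        where
        a : ∀ i d e → e - + 2 * i ≡ (e - + 2 * i - d) + d
        a = solve-∀
      X≗χ : ∀ t → X t ≡ DE (χ t)
      X≗χ (y , i , d , e) = a i d e
        where
        a : ∀ i d e → e - + 2 * i ≡ d + (e - + 2 * i - d)
        a = solve-∀
      φ-Old : ∀ t → Old t × OddD t → New (φ t) × Pos (φ t)
      φ-Old t@(y , i , d , e) (((sol@(eq , d>0 , e>0 , odd) , ¬pos) , ¬diag) , oddD) =
        ((trans (a y i d e) eq , neg⇒ t ¬pos ¬diag , d>0 , oddD) ,
          even⇒ (φ t) (trans (par-E-2I-D t sol) (cong ℙ._⁻¹ oddD))) ,
        subst (0ℤ <_) (b i d e) e>0
        where
        a : ∀ y i d e → y * y + (i + d) * (i + d) + (e - + 2 * i - d) * d ≡ y * y + i * i + d * e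
        a = solve-∀
        b : ∀ i d e → e ≡ (e - + 2 * i - d) + + 2 * (i + d) - d
        b = solve-∀
      φ⁻¹-New : ∀ t → New t × Pos t → Old (φ⁻¹ t) × OddD (φ⁻¹ t)
      φ⁻¹-New t@(y , i , d , e) ((sol@(eq , d>0 , e>0 , odd) , ¬oddD) , pos) =
        (((trans (a y i d e) eq , e>0 , pos , trans (par-L t sol) (cong ℙ._⁻¹ (even-D t ¬oddD))) ,
          proj₁ neg) , proj₂ neg) , odd
        where
        a : ∀ y i d e → y * y + (i - e) * (i - e) + e * (d + + 2 * i - e) ≡ y * y + i * i + d * e
        a = solve-∀
        b : ∀ i d e → - d ≡ e + + 2 * (i - e) - (d + + 2 * i - e)
        b = solve-∀
        neg : ¬ Pos (φ⁻¹ t) × ¬ Diag (φ⁻¹ t)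
        neg = -e<0 d>0 (b i d e)
      χ-eqn : ∀ y i d e → y * y + (- i - d) * (- i - d) + d * (e - + 2 * i - d) ≡ y * y + i * i + d * e
      χ-eqn = solve-∀
      χ-neg : ∀ t → Sol t → ¬ Pos (χ t) × ¬ Diag (χ t)
      χ-neg (y , i , d , e) (_ , _ , e>0 , _) = -e<0 e>0 (b i d e)
        where
        b : ∀ i d e → - e ≡ d + + 2 * (- i - d) - (e - + 2 * i - d)
        b = solve-∀
      χ-Old : ∀ t → Old t × ¬ OddD t → New (χ t) × ¬ Pos (χ t)
      χ-Old t@(y , i , d , e) (((sol@(eq , d>0 , _) , ¬pos) , ¬diag) , ¬oddD) =
        ((trans (χ-eqn y i d e) eq , d>0 , neg⇒ t ¬pos ¬diag ,
          trans (par-E-2I-D t sol) (cong ℙ._⁻¹ (even-D t ¬oddD))) , ¬oddD) ,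
        proj₁ (χ-neg t sol)
      χ-New : ∀ t → New t × ¬ Pos t → Old (χ t) × ¬ OddD (χ t)
      χ-New t@(y , i , d , e) ((sol@(eq , d>0 , _) , ¬oddD) , ¬pos) =
        (((trans (χ-eqn y i d e) eq , d>0 , neg⇒ t ¬pos ¬diag ,
           trans (par-E-2I-D t sol) (cong ℙ._⁻¹ (even-D t ¬oddD))) , proj₁ (χ-neg t sol)) , proj₂ (χ-neg t sol)) ,
        ¬oddD
        where
        -- For even d and odd e the value of `L` is odd, hence not zero.
        ¬diag : ¬ Diag t
        ¬diag diag with () ← trans (sym (cong par diag)) (trans (par-L t sol) (cong ℙ._⁻¹ (even-D t ¬oddD)))

    ∑E₁≡∑D₁ : ∑ S₁ E ≡ ∑ S₁ D
    ∑E₁≡∑D₁ = ∑-bij {w = D} S₁-l S₁-l φ φ (λ _ → refl) (λ _ → refl) φ-Sol φ-Sol (λ _ → refl)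
      where
      φ : Quad → Quad
      φ (y , i , d , e) = y , i , e , d
      φ-Sol : ∀ t → Sol t × OddD t → Sol (φ t) × OddD (φ t)
      φ-Sol (y , i , d , e) ((eq , d>0 , e>0 , odd) , oddD) =
        (trans (cong (_+_ (y * y + i * i)) (ℤ.*-comm e d)) eq , e>0 , d>0 , oddD) , odd

    -- The left side is the sum of `D` over `S₁` minus that over `S₂`. After replacing `D` by `E` on
    -- `S₁`, adding the sum of `E` over `S₂` to both terms completes them to the sum of `X` over `S`
    -- and over `S₋`; their difference is the sum over `S₊`, which is zero, and the diagonal.
    ∑sgn : ∑ S (λ t → sgn (par (D t)) * D t) ≡ ∑ S₀ D
    ∑sgn = begin
      ∑ S W
        ≡⟨ ∑-split oddD? S W ⟩
      ∑ S₁ W + ∑ S₂ W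
        ≡⟨ cong₂ _+_ (∑-cong S₁ λ {t} t∈ → trans (cong (λ q → sgn q * D t) (proj₂ (sound S₁-l t∈))) (ℤ.*-identityˡ (D t)))
                     (trans (∑-cong S₂ λ {t} t∈ → trans (cong (λ q → sgn q * D t) (even-D t (proj₂ (sound S₂-l t∈)))) (ℤ.-1*i≡-i (D t)))
                            (∑-neg S₂ D)) ⟩
      ∑ S₁ D - ∑ S₂ D
        ≡⟨ cong (_- ∑ S₂ D) ∑E₁≡∑D₁ ⟨
      ∑ S₁ E - ∑ S₂ D
        ≡⟨ a (∑ S₁ E) (∑ S₂ D) (∑ S₂ E) ⟩
      (∑ S₁ E + ∑ S₂ E) - (∑ S₂ D + ∑ S₂ E)
        ≡⟨ cong (_- (∑ S₂ D + ∑ S₂ E)) (∑-split oddD? S E) ⟨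
      ∑ S E - (∑ S₂ D + ∑ S₂ E)
        ≡⟨ cong₂ _-_ ∑X≡∑E ∑X₋≡∑D₂+∑E₂ ⟨
      ∑ S X - ∑ S₋ X
        ≡⟨ cong (_- ∑ S₋ X) (trans (∑-split pos? S X) (cong₂ _+_ ∑X₊≡0 (∑-split diag? S₋₀ X))) ⟩
      0ℤ + (∑ S₀ X + ∑ S₋ X) - ∑ S₋ X
        ≡⟨ b (∑ S₀ X) (∑ S₋ X) ⟩
      ∑ S₀ X
        ≡⟨ ∑X₀≡∑D₀ ⟩
      ∑ S₀ D ∎
      where
      open ≡-Reasoning
      W : Quad → ℤ
      W t = sgn (par (D t)) * D t
      a : ∀ s t u → s - t ≡ (s + u) - (t + u)
      a = solve-∀
      b : ∀ s t → 0ℤ + (s + t) - t ≡ s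
      b = solve-∀

    S₀-l : S₀ Lists (λ t → Sol t × Diag t)
    S₀-l = Lists-resp (λ ((sol , _) , diag) → sol , diag)
                      (λ (sol , diag) → (sol , λ pos → ℤ.<⇒≢ pos (sym diag)) , diag)
                      (filter-Lists diag? (filter-Lists (¬? ∘ pos?) S-l))

-- Enumerations of integers, and involutions

upTo-Lists : ∀ n → upTo n Lists (ℕ._< n)
upTo-Lists n = record { unique = Unique.upTo⁺ n ; sound = ∈-upTo⁻ ; complete = ∈-upTo⁺ }

×-Lists : xs Lists P → ys Lists Q → cartesianProduct xs ys Lists (λ (s , t) → P s × Q t)
×-Lists {xs = xs} {ys = ys} xsP ysQ = record
  { unique   = Unique.cartesianProduct⁺ (unique xsP) (unique ysQ)
  ; sound    = λ t∈ → let s∈ , u∈ = ∈-cartesianProduct⁻ xs ys t∈ in sound xsP s∈ , sound ysQ u∈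
  ; complete = λ (p , q) → ∈-cartesianProduct⁺ (complete xsP p) (complete ysQ q)
  }

intRange-Lists : ∀ n → intRange n Lists (λ z → ∣ z ∣ ℕ.≤ n)
intRange-Lists n = record { unique = unique′ ; sound = sound′ ; complete = complete′ }
  where
  neg pos : ℕ → ℤ
  neg k = - (+ k)
  pos k = + suc k
  unique′ : Unique (intRange n)
  unique′ = Unique.++⁺ (Unique.map⁺ {f = neg} (λ eq → ℤ.+-injective (ℤ.neg-injective eq)) (Unique.upTo⁺ (suc n)))
                       (Unique.map⁺ {f = pos} (λ eq → ℕ.suc-injective (ℤ.+-injective eq)) (Unique.upTo⁺ n))
                       disjoint
    where
    disjoint : ∀ {z} → ¬ (z ∈ map neg (upTo (suc n)) × z ∈ map pos (upTo n))
    disjoint (z∈₁ , z∈₂) = let k , _ , eq₁ = ∈-map⁻ neg {xs = upTo (suc n)} z∈₁ ; m , _ , eq₂ = ∈-map⁻ pos z∈₂ in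
                           neg≢pos k m (trans (sym eq₁) eq₂)
      where
      neg≢pos : ∀ k m → neg k ≢ pos m
      neg≢pos zero    m ()
      neg≢pos (suc k) m ()
  sound′ : ∀ {z} → z ∈ intRange n → ∣ z ∣ ℕ.≤ n
  sound′ z∈ with ∈-++⁻ (map neg (upTo (suc n))) z∈
  ... | inj₁ z∈₁ with k , k∈ , refl ← ∈-map⁻ neg {xs = upTo (suc n)} z∈₁ =
    subst (ℕ._≤ n) (sym (ℤ.∣-i∣≡∣i∣ (+ k))) (ℕ.s≤s⁻¹ (∈-upTo⁻ k∈))
  ... | inj₂ z∈₂ with k , k∈ , refl ← ∈-map⁻ pos z∈₂ = ∈-upTo⁻ k∈
  complete′ : ∀ {z} → ∣ z ∣ ℕ.≤ n → z ∈ intRange n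
  complete′ {+ zero}   _   = ∈-++⁺ˡ (∈-map⁺ neg {x = 0} (∈-upTo⁺ {n = suc n} ℕ.z<s))
  complete′ {+ suc k}  k<n = ∈-++⁺ʳ (map neg (upTo (suc n))) (∈-map⁺ pos (∈-upTo⁺ k<n))
  complete′ { -[1+ k ]} k<n = ∈-++⁺ˡ (∈-map⁺ neg (∈-upTo⁺ (ℕ.s≤s k<n)))

i*i≡+∣i∣² : ∀ i → i * i ≡ + (∣ i ∣ ℕ.* ∣ i ∣)
i*i≡+∣i∣² (+ n)    = sym (ℤ.pos-* n n)
i*i≡+∣i∣² -[1+ n ] = refl

m≤m*m : ∀ m → m ℕ.≤ m ℕ.* m
m≤m*m zero    = ℕ.z≤n
m≤m*m (suc m) = ℕ.m≤m*n (suc m) (suc m)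

0<i⇒+∣i∣≡i : ∀ {i} → 0ℤ < i → + ∣ i ∣ ≡ i
0<i⇒+∣i∣≡i = ℤ.0≤i⇒+∣i∣≡i ∘ ℤ.<⇒≤

-- Counting by involutions that reverse a sign

count : List A → ℤ
count xs = ∑ xs (λ _ → 1ℤ)

module _ (h : A → ℤ) where
  zero? : Decidable (λ t → h t ≡ 0ℤ)
  zero? t = h t ℤ.≟ 0ℤ

  positive? : Decidable (λ t → 0ℤ < h t)
  positive? t = 0ℤ ℤ.<? h t

  -- `φ` matches the elements where `h` is negative with those where it is positive. The zeros of
  -- `h` take the role of the fixed points and are found by solving a single equation.
  count-involution : xs Lists P → (φ : A → A) → (∀ t → φ (φ t) ≡ t) → (∀ t → P t → P (φ t)) →
    (∀ t → h (φ t) ≡ - h t) →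
    count xs ≡ count (filter zero? xs) + (count (filter positive? xs) + count (filter positive? xs))
  count-involution {xs = xs} {P = P} xs-l φ φφ φ-P φ-h = begin
    count xs
      ≡⟨ ∑-split zero? xs _ ⟩
    count Z + count N
      ≡⟨ cong (_+_ (count Z)) (∑-split positive? N _) ⟩
    count Z + (count (filter positive? N) + count (filter (¬? ∘ positive?) N))
      ≡⟨ cong (_+_ (count Z)) (cong₂ _+_
           (∑-Lists N₊-l (filter-Lists positive? xs-l) _)
           (∑-bij N₋-l (filter-Lists positive? xs-l) φ φ φφ φφ N₋⇒ ⇒N₋ (λ _ → refl))) ⟩
    count Z + (count (filter positive? xs) + count (filter positive? xs))
      ∎
    where
    open ≡-Reasoning
    Z N : List _
    Z = filter zero? xs
    N = filter (¬? ∘ zero?) xs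
    N₊-l : filter positive? N Lists (λ t → P t × 0ℤ < h t)
    N₊-l = Lists-resp (λ ((p , _) , pos) → p , pos)
                      (λ (p , pos) → (p , λ z → ℤ.<⇒≢ pos (sym z)) , pos)
                      (filter-Lists positive? (filter-Lists (¬? ∘ zero?) xs-l))
    N₋-l = filter-Lists (¬? ∘ positive?) (filter-Lists (¬? ∘ zero?) xs-l)
    N₋⇒ : ∀ t → (P t × ¬ h t ≡ 0ℤ) × ¬ 0ℤ < h t → P (φ t) × 0ℤ < h (φ t)
    N₋⇒ t ((p , h≢0) , h≯0) =
      φ-P t p , subst (0ℤ <_) (sym (φ-h t)) (ℤ.neg-mono-< (ℤ.≤∧≢⇒< (ℤ.≮⇒≥ h≯0) h≢0))
    ⇒N₋ : ∀ t → P t × 0ℤ < h t → (P (φ t) × ¬ h (φ t) ≡ 0ℤ) × ¬ 0ℤ < h (φ t)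
    ⇒N₋ t (p , pos) = (φ-P t p , ℤ.<⇒≢ hφ<0) , ℤ.<-asym hφ<0
      where
      hφ<0 : h (φ t) < 0ℤ
      hφ<0 = subst (_< 0ℤ) (sym (φ-h t)) (ℤ.neg-mono-< pos)

  parity-involution : xs Lists P → (φ : A → A) → (∀ t → φ (φ t) ≡ t) → (∀ t → P t → P (φ t)) →
    (∀ t → h (φ t) ≡ - h t) → par (count xs) ≡ par (count (filter zero? xs))
  parity-involution {xs = xs} xs-l φ φφ φ-P φ-h = begin
    par (count xs)                ≡⟨ cong par (count-involution xs-l φ φφ φ-P φ-h) ⟩
    par (z + (c + c))             ≡⟨ par-+ z (c + c) ⟩
    par z ℙ.+ par (c + c)         ≡⟨ cong (par z ℙ.+_) (trans (par-+ c c) (ℙ.p+p≡0ℙ (par c))) ⟩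
    par z ℙ.+ 0ℙ                  ≡⟨ ℙ.+-identityʳ (par z) ⟩
    par z                         ∎
    where
    open ≡-Reasoning
    z c : ℤ
    z = count (filter zero? xs)
    c = count (filter positive? xs)

i+i≡j+j⇒i≡j : ∀ i j → i + i ≡ j + j → i ≡ j
i+i≡j+j⇒i≡j i j eq = ℤ.i-j≡0⇒i≡j i j (i≡-i⇒i≡0 (begin
  i - j               ≡⟨ a i j ⟩
  (i + i) - (i + j)   ≡⟨ cong (_- (i + j)) eq ⟩
  (j + j) - (i + j)   ≡⟨ b i j ⟩
  - (i - j)           ∎))
  where
  open ≡-Reasoning
  a : ∀ i j → i - j ≡ (i + i) - (i + j)
  a = solve-∀
  b : ∀ i j → (j + j) - (i + j) ≡ - (i - j)
  b = solve-∀

prime-nonsquare : ∀ {p} → Prime p → ∀ i → i * i ≢ + p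
prime-nonsquare {p} pp i eq = case (ℤ.+-injective (trans (sym (i*i≡+∣i∣² i)) eq))
  where
  case : ∣ i ∣ ℕ.* ∣ i ∣ ≢ p
  case m*m≡p with prime⇒irreducible pp (divides ∣ i ∣ (sym m*m≡p))
  ... | inj₁ m≡1 = ¬prime[1] (subst Prime (trans (sym m*m≡p) (cong (λ m → m ℕ.* m) m≡1)) pp)
  ... | inj₂ m≡p = ¬prime[1] (subst Prime p≡1 pp)
    where
    p≡1 : p ≡ 1
    p≡1 = ℕ.*-cancelˡ-≡ p 1 p {{prime⇒nonZero pp}}
            (trans (trans (cong (λ m → m ℕ.* m) (sym m≡p)) m*m≡p) (sym (ℕ.*-identityʳ p)))

0<i⇒nonZero : ∀ {i} → 0ℤ < i → ℕ.NonZero ∣ i ∣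
0<i⇒nonZero {+ suc n} (ℤ.+<+ _) = _

-- Heath-Brown's involutions on the solutions of 4xy + z² = p.
module HeathBrown {p : ℕ} (pp : Prime p) {k : ℕ} (p≡1+4k : p ≡ 1 ℕ.+ 4 ℕ.* suc k) where

  Triple : Set
  Triple = ℤ × ℤ × ℤ

  Z X-Y X-Y+Z Y-Z : Triple → ℤ
  Z     (x , y , z) = z
  X-Y   (x , y , z) = x - y
  X-Y+Z (x , y , z) = x - y + z
  Y-Z   (x , y , z) = y - z

  W : Triple → Set
  W (x , y , z) = (+ 4 * x * y + z * z ≡ + p) × 0ℤ < x × 0ℤ < y

  triple≡ : ∀ {x x′ y y′ z z′ : ℤ} → x ≡ x′ → y ≡ y′ → z ≡ z′ → (x , y , z) ≡ (x′ , y′ , z′)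
  triple≡ refl refl refl = refl

  W-ℕ : ∀ x y z → W (x , y , z) → 4 ℕ.* ∣ x ∣ ℕ.* ∣ y ∣ ℕ.+ ∣ z ∣ ℕ.* ∣ z ∣ ≡ p
  W-ℕ x y z (eq , x>0 , y>0) = ℤ.+-injective (begin
    + (4 ℕ.* a ℕ.* b ℕ.+ c ℕ.* c)   ≡⟨ ℤ.pos-+ (4 ℕ.* a ℕ.* b) (c ℕ.* c) ⟩
    + (4 ℕ.* a ℕ.* b) + + (c ℕ.* c) ≡⟨ cong₂ _+_ (trans (ℤ.pos-* (4 ℕ.* a) b)
                                                    (cong₂ _*_ (trans (ℤ.pos-* 4 a) (cong (_*_ (+ 4)) (0<i⇒+∣i∣≡i x>0))) (0<i⇒+∣i∣≡i y>0)))
                                             (sym (i*i≡+∣i∣² z)) ⟩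
    + 4 * x * y + z * z             ≡⟨ eq ⟩
    + p                             ∎)
    where
    open ≡-Reasoning
    a b c : ℕ
    a = ∣ x ∣
    b = ∣ y ∣
    c = ∣ z ∣

  W? : Decidable W
  W? (x , y , z) = (_ ℤ.≟ _) ×-dec (_ ℤ.<? _) ×-dec (_ ℤ.<? _)

  W-bounds : ∀ x y z → W (x , y , z) → ∣ x ∣ ℕ.≤ p × ∣ y ∣ ℕ.≤ p × ∣ z ∣ ℕ.≤ p
  W-bounds x y z w@(_ , x>0 , y>0) =
    ℕ.≤-trans (ℕ.≤-trans (ℕ.m≤n*m a 4) (ℕ.m≤m*n (4 ℕ.* a) b)) 4ab≤p ,
    ℕ.≤-trans (ℕ.m≤n*m b (4 ℕ.* a) {{ℕ.m*n≢0 4 a}}) 4ab≤p ,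
    ℕ.≤-trans (m≤m*m c) (subst (c ℕ.* c ℕ.≤_) (W-ℕ x y z w) (ℕ.m≤n+m (c ℕ.* c) (4 ℕ.* a ℕ.* b)))
    where
    a b c : ℕ
    a = ∣ x ∣
    b = ∣ y ∣
    c = ∣ z ∣
    4ab≤p : 4 ℕ.* a ℕ.* b ℕ.≤ p
    4ab≤p = subst (4 ℕ.* a ℕ.* b ℕ.≤_) (W-ℕ x y z w) (ℕ.m≤m+n (4 ℕ.* a ℕ.* b) (c ℕ.* c))
    instance
      a≢0 : ℕ.NonZero a
      a≢0 = 0<i⇒nonZero x>0
      b≢0 : ℕ.NonZero b
      b≢0 = 0<i⇒nonZero y>0

  ws ts us : List Triple
  ws = filter W? (cartesianProduct (intRange p) (cartesianProduct (intRange p) (intRange p)))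
  ts = filter (positive? Z) ws
  us = filter (positive? X-Y+Z) ws

  ws-l : ws Lists W
  ws-l = Lists-resp proj₂ (λ {(x , y , z)} w → W-bounds x y z w , w)
           (filter-Lists W? (×-Lists (intRange-Lists p) (×-Lists (intRange-Lists p) (intRange-Lists p))))
  ts-l = filter-Lists (positive? Z) ws-l
  us-l = filter-Lists (positive? X-Y+Z) ws-l

  par-p : par (+ p) ≡ 1ℙ
  par-p = trans (cong parity p≡1+4k)
    (trans (ℙ.+-homo-+ 1 (4 ℕ.* suc k)) (cong (1ℙ ℙ.+_) (ℙ.*-homo-* 4 (suc k))))

  W⇒Z≢0 : ∀ t → W t → Z t ≢ 0ℤ
  W⇒Z≢0 (x , y , .0ℤ) (eq , _) refl = ℙ.p≢p⁻¹ 0ℙ (trans (sym even) (trans (cong par eq) par-p))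
    where
    even : par (+ 4 * x * y + 0ℤ) ≡ 0ℙ
    even = trans (par-+ (+ 4 * x * y) 0ℤ) (trans (ℙ.+-identityʳ _)
             (trans (par-* (+ 4 * x) y) (cong (ℙ._* par y) (par-* (+ 4) x))))

  -- (x + y)² differs from 4xy + z² by (x - y + z)(x - y - z), so a zero of the first factor would
  -- make p a square.
  W⇒X-Y+Z≢0 : ∀ t → W t → X-Y+Z t ≢ 0ℤ
  W⇒X-Y+Z≢0 (x , y , z) (eq , _) x-y+z≡0 = prime-nonsquare pp (x + y) (begin
    (x + y) * (x + y)                                             ≡⟨ a x y z ⟩
    + 4 * x * y + z * z + (x - y + z) * (x - y - z)               ≡⟨ cong (λ l → + 4 * x * y + z * z + l * (x - y - z)) x-y+z≡0 ⟩
    + 4 * x * y + z * z + 0ℤ                                      ≡⟨ ℤ.+-identityʳ _ ⟩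
    + 4 * x * y + z * z                                           ≡⟨ eq ⟩
    + p                                                           ∎)
    where
    open ≡-Reasoning
    a : ∀ x y z → (x + y) * (x + y) ≡ + 4 * x * y + z * z + (x - y + z) * (x - y - z)
    a = solve-∀

  count-half : ∀ h (φ : Triple → Triple) → (∀ t → φ (φ t) ≡ t) → (∀ t → W t → W (φ t)) →
               (∀ t → h (φ t) ≡ - h t) → (∀ t → W t → h t ≢ 0ℤ) →
               count ws ≡ count (filter (positive? h) ws) + count (filter (positive? h) ws)
  count-half h φ φφ φ-W φ-h h≢0 =
    trans (count-involution h ws-l φ φφ φ-W φ-h)
      (trans (cong (_+ (c + c)) (∑-none (sound (filter-Lists (zero? h) ws-l)) (λ {t} (w , z) → h≢0 t w z) _))
             (ℤ.+-identityˡ (c + c)))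
    where
    c : ℤ
    c = count (filter (positive? h) ws)

  -- The map to (y, x, -z) reverses both `Z` and `X-Y+Z`, and neither vanishes on `W`. Hence `ts`
  -- and `us` are each half of `ws`.
  count-ts≡count-us : count ts ≡ count us
  count-ts≡count-us = i+i≡j+j⇒i≡j (count ts) (count us)
    (trans (sym (count-half Z φ φφ φ-W (λ _ → refl) W⇒Z≢0))
           (count-half X-Y+Z φ φφ φ-W φ-h W⇒X-Y+Z≢0))
    where
    φ : Triple → Triple
    φ (x , y , z) = y , x , - z
    φφ : ∀ t → φ (φ t) ≡ t
    φφ (x , y , z) = triple≡ refl refl (ℤ.neg-involutive z)
    φ-W : ∀ t → W t → W (φ t)
    φ-W (x , y , z) (eq , x>0 , y>0) = trans (a x y z) eq , y>0 , x>0
      where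
      a : ∀ x y z → + 4 * y * x + - z * - z ≡ + 4 * x * y + z * z
      a = solve-∀
    φ-h : ∀ t → X-Y+Z (φ t) ≡ - X-Y+Z t
    φ-h (x , y , z) = a x y z
      where
      a : ∀ x y z → y - x + - z ≡ - (x - y + z)
      a = solve-∀

  us-fixed : filter (zero? Y-Z) us Lists (λ t → (W t × 0ℤ < X-Y+Z t) × Y-Z t ≡ 0ℤ)
  us-fixed = filter-Lists (zero? Y-Z) us-l

  -- y = z makes y (4x + y) = p, which forces y = 1.
  one-fixed : ((+ suc k , 1ℤ , 1ℤ) ∷ []) Lists (λ t → (W t × 0ℤ < X-Y+Z t) × Y-Z t ≡ 0ℤ)
  one-fixed = record
    { unique   = All.[] ∷ []
    ; sound    = λ { (here refl) → ((eqn , ℤ.+<+ ℕ.z<s , ℤ.+<+ ℕ.z<s) , subst (0ℤ <_) (a (+ suc k)) (ℤ.+<+ ℕ.z<s)) , refl }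
    ; complete = λ {t} → fixed⇒ t
    }
    where
    a : ∀ x → x ≡ x - 1ℤ + 1ℤ
    a = solve-∀
    eqn : + 4 * + suc k * 1ℤ + 1ℤ ≡ + p
    eqn = trans (trans (b (+ suc k)) (cong (_+_ 1ℤ) (sym (ℤ.pos-* 4 (suc k))))) (cong +_ (sym p≡1+4k))
      where
      b : ∀ x → + 4 * x * 1ℤ + 1ℤ ≡ 1ℤ + + 4 * x
      b = solve-∀
    b≡1⇒ : ∀ a b → 0 ℕ.< a → (4 ℕ.* a ℕ.+ b) ℕ.* b ≡ p → b ≡ 1
    b≡1⇒ a b a>0 eq with prime⇒irreducible pp (divides b (trans (sym eq) (ℕ.*-comm (4 ℕ.* a ℕ.+ b) b)))
    b≡1⇒ (suc a) b a>0 eq | inj₁ 4a+b≡1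
      with () ← ℕ.<⇒≢ (ℕ.<-≤-trans (ℕ.s<s ℕ.z<s)
                     (ℕ.≤-trans (ℕ.*-monoʳ-≤ 4 (ℕ.s≤s ℕ.z≤n)) (ℕ.m≤m+n (4 ℕ.* suc a) b))) (sym 4a+b≡1)
    b≡1⇒ a b a>0 eq | inj₂ 4a+b≡p = ℕ.*-cancelˡ-≡ b 1 p {{prime⇒nonZero pp}}
      (trans (trans (cong (ℕ._* b) (sym 4a+b≡p)) eq) (sym (ℕ.*-identityʳ p)))
    fixed⇒ : ∀ t → (W t × 0ℤ < X-Y+Z t) × Y-Z t ≡ 0ℤ → t ∈ (+ suc k , 1ℤ , 1ℤ) ∷ []
    fixed⇒ (x , y , z) ((w@(eq , x>0 , y>0) , _) , y-z≡0) with refl ← ℤ.i-j≡0⇒i≡j y z y-z≡0 =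
      here (triple≡ (trans (sym (0<i⇒+∣i∣≡i x>0)) (cong +_ ∣x∣≡k)) y≡1 y≡1)
      where
      ∣y∣≡1 : ∣ y ∣ ≡ 1
      ∣y∣≡1 = b≡1⇒ (∣ x ∣) (∣ y ∣) (ℕ.n≢0⇒n>0 (ℕ.≢-nonZero⁻¹ _ {{0<i⇒nonZero x>0}}))
                (trans (ℕ.*-distribʳ-+ (∣ y ∣) (4 ℕ.* ∣ x ∣) (∣ y ∣)) (W-ℕ x y y w))
      y≡1 : y ≡ 1ℤ
      y≡1 = trans (sym (0<i⇒+∣i∣≡i y>0)) (cong +_ ∣y∣≡1)
      ∣x∣≡k : ∣ x ∣ ≡ suc k
      ∣x∣≡k = ℕ.*-cancelˡ-≡ (∣ x ∣) (suc k) 4 (ℕ.+-cancelʳ-≡ 1 (4 ℕ.* ∣ x ∣) (4 ℕ.* suc k) (begin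
        4 ℕ.* ∣ x ∣ ℕ.+ 1                            ≡⟨ cong (ℕ._+ 1) (sym (ℕ.*-identityʳ (4 ℕ.* ∣ x ∣))) ⟩
        4 ℕ.* ∣ x ∣ ℕ.* 1 ℕ.+ 1 ℕ.* 1                ≡⟨ cong (λ b → 4 ℕ.* ∣ x ∣ ℕ.* b ℕ.+ b ℕ.* b) (sym ∣y∣≡1) ⟩
        4 ℕ.* ∣ x ∣ ℕ.* ∣ y ∣ ℕ.+ ∣ y ∣ ℕ.* ∣ y ∣    ≡⟨ W-ℕ x y y w ⟩
        p                                            ≡⟨ p≡1+4k ⟩
        1 ℕ.+ 4 ℕ.* suc k                            ≡⟨ ℕ.+-comm 1 (4 ℕ.* suc k) ⟩
        4 ℕ.* suc k ℕ.+ 1                            ∎))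
        where open ≡-Reasoning

  -- The involution exchanges x with x - y + z, both positive on `us`, and reflects z in y; the
  -- zeros of y - z reduce to a single triple.
  count-us-odd : par (count us) ≡ 1ℙ
  count-us-odd = trans (parity-involution Y-Z us-l φ φφ φ-U φ-h) (cong par (∑-Lists us-fixed one-fixed _))
    where
    φ : Triple → Triple
    φ (x , y , z) = x - y + z , y , + 2 * y - z
    φφ : ∀ t → φ (φ t) ≡ t
    φφ (x , y , z) = triple≡ (a x y z) refl (b y z)
      where
      a : ∀ x y z → (x - y + z) - y + (+ 2 * y - z) ≡ x
      a = solve-∀
      b : ∀ y z → + 2 * y - (+ 2 * y - z) ≡ z
      b = solve-∀
    φ-U : ∀ t → W t × 0ℤ < X-Y+Z t → W (φ t) × 0ℤ < X-Y+Z (φ t)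
    φ-U (x , y , z) ((eq , x>0 , y>0) , pos) = (trans (a x y z) eq , pos , y>0) , subst (0ℤ <_) (b x y z) x>0
      where
      a : ∀ x y z → + 4 * (x - y + z) * y + (+ 2 * y - z) * (+ 2 * y - z) ≡ + 4 * x * y + z * z
      a = solve-∀
      b : ∀ x y z → x ≡ (x - y + z) - y + (+ 2 * y - z)
      b = solve-∀
    φ-h : ∀ t → Y-Z (φ t) ≡ - Y-Z t
    φ-h (x , y , z) = a y z
      where
      a : ∀ y z → y - (+ 2 * y - z) ≡ - (y - z)
      a = solve-∀

  count-ts-fixed-odd : par (count (filter (zero? X-Y) ts)) ≡ 1ℙ
  count-ts-fixed-odd = begin
    par (count (filter (zero? X-Y) ts))   ≡⟨ parity-involution X-Y ts-l φ (λ _ → refl) φ-T φ-h ⟨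
    par (count ts)                        ≡⟨ cong par count-ts≡count-us ⟩
    par (count us)                        ≡⟨ count-us-odd ⟩
    1ℙ                                    ∎
    where
    open ≡-Reasoning
    φ : Triple → Triple
    φ (x , y , z) = y , x , z
    φ-T : ∀ t → W t × 0ℤ < Z t → W (φ t) × 0ℤ < Z (φ t)
    φ-T (x , y , z) ((eq , x>0 , y>0) , z>0) = (trans (a x y z) eq , y>0 , x>0) , z>0
      where
      a : ∀ x y z → + 4 * y * x + z * z ≡ + 4 * x * y + z * z
      a = solve-∀
    φ-h : ∀ t → X-Y (φ t) ≡ - X-Y t
    φ-h (x , y , z) = a x y
      where
      a : ∀ x y → y - x ≡ - (x - y)
      a = solve-∀

  -- An odd count is not zero, so some triple has x = y, and 4xy + z² becomes (2x)² + z². If z were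
  -- 2x, then p would be even. The inequality is recorded because the representations on the
  -- diagonal must be distinct.
  two-squares : ∃ λ a → ∃ λ b → a * a + b * b ≡ + p × 0ℤ < a × 0ℤ < b × a ≢ b
  two-squares = from _ (filter-Lists (zero? X-Y) ts-l) count-ts-fixed-odd
    where
    from : ∀ fs → fs Lists (λ t → (W t × 0ℤ < Z t) × X-Y t ≡ 0ℤ) → par (count fs) ≡ 1ℙ →
           ∃ λ a → ∃ λ b → a * a + b * b ≡ + p × 0ℤ < a × 0ℤ < b × a ≢ b
    from []                fs-l ()
    from ((x , y , z) ∷ _) fs-l _ with sound fs-l (here refl)
    ... | ((eq , x>0 , y>0) , z>0) , x-y≡0 with refl ← ℤ.i-j≡0⇒i≡j x y x-y≡0 =
      z , + 2 * x , trans (a x z) eq , z>0 , ℤ.*-monoˡ-<-pos (+ 2) x>0 , z≢2x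
      where
      a : ∀ x z → z * z + (+ 2 * x) * (+ 2 * x) ≡ + 4 * x * x + z * z
      a = solve-∀
      z≢2x : z ≢ + 2 * x
      z≢2x refl = ℙ.p≢p⁻¹ 0ℙ (trans (sym (par-* (+ 2) (+ 4 * x * x))) (trans (cong par (trans (sym (b x)) eq)) par-p))
        where
        b : ∀ x → + 4 * x * x + (+ 2 * x) * (+ 2 * x) ≡ + 2 * (+ 4 * x * x)
        b = solve-∀

-- Uniqueness of the representation as a sum of two squares

squares-eq : ∀ {i j} → i * i ≡ j * j → i ≡ j ⊎ i ≡ - j
squares-eq {i} {j} eq with ℤ.i*j≡0⇒i≡0∨j≡0 (i - j) (trans (factor i j) (ℤ.i≡j⇒i-j≡0 eq))
  where
  factor : ∀ i j → (i - j) * (i + j) ≡ i * i - j * j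
  factor = solve-∀
... | inj₁ i-j≡0 = inj₁ (ℤ.i-j≡0⇒i≡j i j i-j≡0)
... | inj₂ i+j≡0 = inj₂ (ℤ.i-j≡0⇒i≡j i (- j) (trans (cong (_+_ i) (ℤ.neg-involutive j)) i+j≡0))

squares-eq-pos : ∀ {i j} → 0ℤ < i → 0ℤ < j → i * i ≡ j * j → i ≡ j
squares-eq-pos i>0 j>0 eq with squares-eq eq
... | inj₁ i≡j    = i≡j
... | inj₂ refl   = ⊥-elim (ℤ.<-asym i>0 (ℤ.neg-mono-< j>0))

sum-squares≡1 : ∀ i j → i * i + j * j ≡ 1ℤ → i ≡ 0ℤ ⊎ j ≡ 0ℤ
sum-squares≡1 i j eq = Sum.map ℤ.∣i∣≡0⇒i≡0 ℤ.∣i∣≡0⇒i≡0 (go (∣ i ∣) (∣ j ∣)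
  (ℤ.+-injective (trans (cong₂ _+_ (sym (i*i≡+∣i∣² i)) (sym (i*i≡+∣i∣² j))) eq)))
  where
  go : ∀ m n → m ℕ.* m ℕ.+ n ℕ.* n ≡ 1 → m ≡ 0 ⊎ n ≡ 0
  go zero    n       _  = inj₁ refl
  go (suc m) zero    _  = inj₂ refl
  go (suc m) (suc n) eq with () ← trans (sym (ℕ.+-suc _ _)) (ℕ.suc-injective eq)

module _ {p : ℕ} (pp : Prime p) where

  private instance
    p≢0 : ℕ.NonZero p
    p≢0 = prime⇒nonZero pp

  euclid-ℤ : ∀ i j k → i * j ≡ + p * k → + p ℤ.∣ i ⊎ + p ℤ.∣ j
  euclid-ℤ i j k eq = Sum.map ℤ.∣ᵤ⇒∣ ℤ.∣ᵤ⇒∣ (euclidsLemma (∣ i ∣) (∣ j ∣) pp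
    (divides (∣ k ∣) (trans (sym (ℤ.abs-* i j)) (trans (cong ∣_∣ eq) (trans (ℤ.abs-* (+ p) k) (ℕ.*-comm p (∣ k ∣)))))))

  -- Brahmagupta: (ac + bd)² + (ad - bc)² = p².
  two-squares-unique-∣ : ∀ {a b c d} → a * a + b * b ≡ + p → c * c + d * d ≡ + p →
                         + p ℤ.∣ a * d - b * c → c * c ≡ a * a ⊎ d * d ≡ a * a
  two-squares-unique-∣ {a} {b} {c} {d} eq₁ eq₂ (ℤ.divides q v≡qp) = Sum.[ q-case , l-case ]′ (Sum.swap (sum-squares≡1 l q l²+q²≡1))
    where
    open ≡-Reasoning
    π u v : ℤ
    π = + p
    u = a * c + b * d
    v = a * d - b * c
    brahmagupta : u * u + v * v ≡ π * π
    brahmagupta = trans (e a b c d) (cong₂ _*_ eq₁ eq₂)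
      where
      e : ∀ a b c d → (a * c + b * d) * (a * c + b * d) + (a * d - b * c) * (a * d - b * c) ≡ (a * a + b * b) * (c * c + d * d)
      e = solve-∀
    -- u² = p² - v², and p divides v.
    p∣u : π ℤ.∣ u
    p∣u = Sum.[ id , id ]′ (euclid-ℤ u u (π - q * q * π) (begin
      u * u                            ≡⟨ e u v ⟩
      u * u + v * v - v * v            ≡⟨ cong₂ (λ x y → x - y * y) brahmagupta v≡qp ⟩
      π * π - (q * π) * (q * π)        ≡⟨ f π q ⟩
      π * (π - q * q * π)              ∎))
      where
      e : ∀ u v → u * u ≡ u * u + v * v - v * v
      e = solve-∀
      f : ∀ p q → p * p - (q * p) * (q * p) ≡ p * (p - q * q * p)
      f = solve-∀
    l : ℤ
    l = ℤ._∣_.quotient p∣u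
    u≡lp : u ≡ l * π
    u≡lp = ℤ._∣_.equality p∣u
    l²+q²≡1 : l * l + q * q ≡ 1ℤ
    l²+q²≡1 = ℤ.*-cancelʳ-≡ _ _ π (ℤ.*-cancelʳ-≡ _ _ π (begin
      (l * l + q * q) * π * π                ≡⟨ e l q π ⟩
      (l * π) * (l * π) + (q * π) * (q * π)  ≡⟨ cong₂ (λ x y → x * x + y * y) u≡lp v≡qp ⟨
      u * u + v * v                          ≡⟨ brahmagupta ⟩
      π * π                                  ≡⟨ cong (_* π) (ℤ.*-identityˡ π) ⟨
      1ℤ * π * π                             ∎))
      where
      e : ∀ l q p → (l * l + q * q) * p * p ≡ (l * p) * (l * p) + (q * p) * (q * p)
      e = solve-∀
    -- In Gaussian integers (a - bi)(c + di) = u + vi = p(l + qi), so c + di = (a + bi)(l + qi),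
    -- where l + qi has norm 1. This equation and the next are its real and imaginary parts.
    c≡al-bq : c ≡ a * l - b * q
    c≡al-bq = ℤ.*-cancelʳ-≡ _ _ π (begin
      c * π                        ≡⟨ cong (_*_ c) eq₁ ⟨
      c * (a * a + b * b)          ≡⟨ e a b c d ⟩
      a * u - b * v                ≡⟨ cong₂ (λ x y → a * x - b * y) u≡lp v≡qp ⟩
      a * (l * π) - b * (q * π)    ≡⟨ f a b l q π ⟩
      (a * l - b * q) * π          ∎)
      where
      e : ∀ a b c d → c * (a * a + b * b) ≡ a * (a * c + b * d) - b * (a * d - b * c)
      e = solve-∀
      f : ∀ a b l q p → a * (l * p) - b * (q * p) ≡ (a * l - b * q) * p
      f = solve-∀
    d≡aq+bl : d ≡ a * q + b * l
    d≡aq+bl = ℤ.*-cancelʳ-≡ _ _ π (begin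
      d * π                        ≡⟨ cong (_*_ d) eq₁ ⟨
      d * (a * a + b * b)          ≡⟨ e a b c d ⟩
      a * v + b * u                ≡⟨ cong₂ (λ x y → a * y + b * x) u≡lp v≡qp ⟩
      a * (q * π) + b * (l * π)    ≡⟨ f a b l q π ⟩
      (a * q + b * l) * π          ∎)
      where
      e : ∀ a b c d → d * (a * a + b * b) ≡ a * (a * d - b * c) + b * (a * c + b * d)
      e = solve-∀
      f : ∀ a b l q p → a * (q * p) + b * (l * p) ≡ (a * q + b * l) * p
      f = solve-∀
    q-case : q ≡ 0ℤ → c * c ≡ a * a ⊎ d * d ≡ a * a
    q-case q≡0 = inj₁ (begin
      c * c                                          ≡⟨ cong (λ x → x * x) (trans c≡al-bq (cong (λ y → a * l - b * y) q≡0)) ⟩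
      (a * l - b * 0ℤ) * (a * l - b * 0ℤ)            ≡⟨ e a b l ⟩
      a * a * (l * l + 0ℤ * 0ℤ)                      ≡⟨ cong (λ y → a * a * (l * l + y * y)) q≡0 ⟨
      a * a * (l * l + q * q)                        ≡⟨ cong (_*_ (a * a)) l²+q²≡1 ⟩
      a * a * 1ℤ                                     ≡⟨ ℤ.*-identityʳ (a * a) ⟩
      a * a                                          ∎)
      where
      e : ∀ a b l → (a * l - b * 0ℤ) * (a * l - b * 0ℤ) ≡ a * a * (l * l + 0ℤ * 0ℤ)
      e = solve-∀
    l-case : l ≡ 0ℤ → c * c ≡ a * a ⊎ d * d ≡ a * a
    l-case l≡0 = inj₂ (begin
      d * d                                          ≡⟨ cong (λ x → x * x) (trans d≡aq+bl (cong (λ y → a * q + b * y) l≡0)) ⟩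
      (a * q + b * 0ℤ) * (a * q + b * 0ℤ)            ≡⟨ e a b q ⟩
      a * a * (0ℤ * 0ℤ + q * q)                      ≡⟨ cong (λ y → a * a * (y * y + q * q)) l≡0 ⟨
      a * a * (l * l + q * q)                        ≡⟨ cong (_*_ (a * a)) l²+q²≡1 ⟩
      a * a * 1ℤ                                     ≡⟨ ℤ.*-identityʳ (a * a) ⟩
      a * a                                          ∎)
      where
      e : ∀ a b q → (a * q + b * 0ℤ) * (a * q + b * 0ℤ) ≡ a * a * (0ℤ * 0ℤ + q * q)
      e = solve-∀

  -- p divides (ad - bc)(ad + bc) = p(a² - c²), hence one of the factors. Replacing b by -b turns
  -- the second factor into the first and leaves b² and the conclusion unchanged.
  two-squares-unique : ∀ {a b c d} → a * a + b * b ≡ + p → c * c + d * d ≡ + p →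
                       c * c ≡ a * a ⊎ d * d ≡ a * a
  two-squares-unique {a} {b} {c} {d} eq₁ eq₂ =
    Sum.[ two-squares-unique-∣ {a} {b} {c} {d} eq₁ eq₂
        , (λ p∣ → two-squares-unique-∣ {a} { - b} {c} {d} (trans (neg² a b) eq₁) eq₂ (subst (ℤ._∣_ (+ p)) (neg-b a b c d) p∣))
        ]′ (euclid-ℤ (a * d - b * c) (a * d + b * c) (a * a - c * c) (begin
      (a * d - b * c) * (a * d + b * c)                                      ≡⟨ e a b c d ⟩
      a * a * (c * c + d * d) - (a * a + b * b) * (c * c)                    ≡⟨ cong₂ (λ x y → a * a * x - y * (c * c)) eq₂ eq₁ ⟩
      a * a * + p - + p * (c * c)                                            ≡⟨ f (a * a) (c * c) (+ p) ⟩
      + p * (a * a - c * c)                                                  ∎))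
    where
    open ≡-Reasoning
    e : ∀ a b c d → (a * d - b * c) * (a * d + b * c) ≡ a * a * (c * c + d * d) - (a * a + b * b) * (c * c)
    e = solve-∀
    f : ∀ x y p → x * p - p * y ≡ p * (x - y)
    f = solve-∀
    neg² : ∀ a b → a * a + - b * - b ≡ a * a + b * b
    neg² = solve-∀
    neg-b : ∀ a b c d → a * d + b * c ≡ a * d - - b * c
    neg-b = solve-∀

-- A general `c` makes the induction work: shifting the index by one replaces `c` by `c - 2`. The
-- use is m = s and c = 2s, with value s².
∑-odds : ∀ m c → ∑ (upTo m) (λ k → c - (1ℤ + + 2 * + k)) ≡ + m * c - + m * + m
∑-odds zero    c = refl
∑-odds (suc m) c = begin
  c - 1ℤ + ∑ (applyUpTo suc m) f                     ≡⟨ cong (λ ks → c - 1ℤ + ∑ ks f) (map-upTo suc m) ⟨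
  c - 1ℤ + ∑ (map suc (upTo m)) f                    ≡⟨ cong (_+_ (c - 1ℤ)) (∑-map suc (upTo m) f) ⟩
  c - 1ℤ + ∑ (upTo m) (f ∘ suc)                      ≡⟨ cong (_+_ (c - 1ℤ)) (∑-cong (upTo m) (λ {k} _ → shift c (+ k))) ⟩
  c - 1ℤ + ∑ (upTo m) (λ k → (c - + 2) - (1ℤ + + 2 * + k)) ≡⟨ cong (_+_ (c - 1ℤ)) (∑-odds m (c - + 2)) ⟩
  c - 1ℤ + (+ m * (c - + 2) - + m * + m)             ≡⟨ e c (+ m) ⟩
  (1ℤ + + m) * c - (1ℤ + + m) * (1ℤ + + m)           ∎
  where
  open ≡-Reasoning
  f : ℕ → ℤ
  f k = c - (1ℤ + + 2 * + k)
  shift : ∀ c k → c - (1ℤ + + 2 * (1ℤ + k)) ≡ (c - + 2) - (1ℤ + + 2 * k)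
  shift = solve-∀
  e : ∀ c m → c - 1ℤ + (m * (c - + 2) - m * m) ≡ (1ℤ + m) * c - (1ℤ + m) * (1ℤ + m)
  e = solve-∀

odd-form : ∀ m → parity m ≡ 1ℙ → ∃ λ k → m ≡ 1 ℕ.+ 2 ℕ.* k
odd-form 1       _   = 0 , refl
odd-form (ℕ.2+ m) odd = let k , eq = odd-form m odd in
  suc k , cong ℕ.2+ (trans eq (sym (ℕ.+-suc k (k ℕ.+ 0))))

i+i>0⇒i>0 : ∀ {i} → 0ℤ < i + i → 0ℤ < i
i+i>0⇒i>0 {+ suc i} _ = ℤ.+<+ ℕ.z<s
i+i>0⇒i>0 {+ zero} (ℤ.+<+ ())
i+i>0⇒i>0 { -[1+ i ]} ()

-- The diagonal terms

i<j⇒0<j-i : ∀ {i j} → i < j → 0ℤ < j - i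
i<j⇒0<j-i {i} {j} i<j = subst (_< j - i) (ℤ.+-inverseʳ i) (ℤ.+-monoˡ-< (- i) i<j)

0<j-i⇒i<j : ∀ {i j} → 0ℤ < j - i → i < j
0<j-i⇒i<j {i} {j} 0<j-i = subst₂ _<_ (ℤ.+-identityʳ i) (e i j) (ℤ.+-monoʳ-< i 0<j-i)
  where
  e : ∀ i j → i + (j - i) ≡ j
  e = solve-∀

module Diagonal {p : ℕ} (pp : Prime p) where
  open Liouville (+ p)

  diag-Sol : Quad → Set
  diag-Sol t = Sol t × Diag t

  -- On the diagonal d = e - 2i, so i² + de = (e - i)².
  diag⇒squares : ∀ t → diag-Sol t → proj₁ t * proj₁ t + (E t - I t) * (E t - I t) ≡ + p
  diag⇒squares (y , i , d , e) ((eq , _) , diag) = begin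
    y * y + (e - i) * (e - i)                         ≡⟨ f y i d e ⟩
    y * y + i * i + d * e - (d + + 2 * i - e) * e     ≡⟨ cong₂ (λ z l → z - l * e) eq diag ⟩
    + p - 0ℤ                                          ≡⟨ ℤ.+-identityʳ (+ p) ⟩
    + p                                               ∎
    where
    open ≡-Reasoning
    f : ∀ y i d e → y * y + (e - i) * (e - i) ≡ y * y + i * i + d * e - (d + + 2 * i - e) * e
    f = solve-∀

  diag⇒0<e-i : ∀ t → diag-Sol t → 0ℤ < E t - I t
  diag⇒0<e-i (y , i , d , e) ((_ , d>0 , e>0 , _) , diag) = i+i>0⇒i>0 (subst (0ℤ <_) eq (ℤ.+-mono-< d>0 e>0))
    where
    f : ∀ i d e → d + e ≡ (e - i) + (e - i) + (d + + 2 * i - e)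
    f = solve-∀
    eq : d + e ≡ (e - i) + (e - i)
    eq = trans (f i d e) (trans (cong (_+_ ((e - i) + (e - i))) diag) (ℤ.+-identityʳ _))

  Key : Quad → ℤ × ℤ → Set
  Key t@(y , _) j = (y , E t - I t) ≡ j

  -- With s = e - i fixed, the diagonal condition gives i = e - s and d = 2s - e, so the only
  -- freedom is an odd e with 0 < e < 2s.
  fibre : ℤ × ℤ → List Quad
  fibre (y , s) = map point (upTo (∣ s ∣))
    module Fibre where
    odd : ℕ → ℤ
    odd k = 1ℤ + + 2 * + k
    point : ℕ → Quad
    point k = y , odd k - s , + 2 * s - odd k , odd k

  fibre-Lists : ∀ {y s} → y * y + s * s ≡ + p → 0ℤ < s → fibre (y , s) Lists (λ t → diag-Sol t × Key t (y , s))
  fibre-Lists {y} {s} eq s>0 = record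
    { unique   = Unique.map⁺ (λ same → odd-injective (cong (proj₂ ∘ proj₂ ∘ proj₂) same)) (Unique.upTo⁺ ∣ s ∣)
    ; sound    = λ t∈ → let k , k∈ , t≡ = ∈-map⁻ point t∈ in subst (λ t → diag-Sol t × Key t (y , s)) (sym t≡) (point-sound k (∈-upTo⁻ k∈))
    ; complete = λ {t} → complete′ t
    }
    where
    open Fibre y s
    odd≡ : ∀ k → odd k ≡ + (1 ℕ.+ 2 ℕ.* k)
    odd≡ k = sym (trans (ℤ.pos-+ 1 (2 ℕ.* k)) (cong (_+_ 1ℤ) (ℤ.pos-* 2 k)))
    2s≡ : + 2 * s ≡ + (2 ℕ.* ∣ s ∣)
    2s≡ = sym (trans (ℤ.pos-* 2 ∣ s ∣) (cong (_*_ (+ 2)) (0<i⇒+∣i∣≡i s>0)))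
    odd-injective : ∀ {j k} → odd j ≡ odd k → j ≡ k
    odd-injective {j} {k} same = ℕ.*-cancelˡ-≡ j k 2 (ℕ.suc-injective
      (ℤ.+-injective (trans (sym (odd≡ j)) (trans same (odd≡ k)))))
    point-sound : ∀ k → k ℕ.< ∣ s ∣ → diag-Sol (point k) × Key (point k) (y , s)
    point-sound k k<s =
      ((trans (e y s (odd k)) eq ,
        i<j⇒0<j-i odd<2s ,
        subst (0ℤ <_) (sym (odd≡ k)) (ℤ.+<+ ℕ.z<s) ,
        trans (cong par (odd≡ k)) (trans (ℙ.+-homo-+ 1 (2 ℕ.* k)) (cong (1ℙ ℙ.+_) (ℙ.*-homo-* 2 k)))) ,
       f s (odd k)) , cong (y ,_) (g s (odd k))
      where
      odd<2s : odd k < + 2 * s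
      odd<2s = subst₂ _<_ (sym (odd≡ k)) (sym 2s≡)
        (ℤ.+<+ (ℕ.<-≤-trans (ℕ.≤-reflexive (sym (ℕ.*-suc 2 k))) (ℕ.*-monoʳ-≤ 2 k<s)))
      e : ∀ y s o → y * y + (o - s) * (o - s) + (+ 2 * s - o) * o ≡ y * y + s * s
      e = solve-∀
      f : ∀ s o → (+ 2 * s - o) + + 2 * (o - s) - o ≡ 0ℤ
      f = solve-∀
      g : ∀ s o → o - (o - s) ≡ s
      g = solve-∀
    complete′ : ∀ t → diag-Sol t × Key t (y , s) → t ∈ map point (upTo ∣ s ∣)
    complete′ t@(_ , i , d , e) (((_ , d>0 , e>0 , e-odd) , diag) , refl) with k , ∣e∣≡ ← odd-form ∣ e ∣ e-odd =
      subst (_∈ map point (upTo ∣ s ∣)) (sym t≡) (∈-map⁺ point (∈-upTo⁺ k<s))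
      where
      e≡ : e ≡ odd k
      e≡ = trans (sym (0<i⇒+∣i∣≡i e>0)) (trans (cong +_ ∣e∣≡) (sym (odd≡ k)))
      d≡ : d ≡ + 2 * (e - i) - e
      d≡ = ℤ.i-j≡0⇒i≡j d _ (trans (f i d e) diag)
        where
        f : ∀ i d e → d - (+ 2 * (e - i) - e) ≡ d + + 2 * i - e
        f = solve-∀
      t≡ : t ≡ point k
      t≡ = quad≡ (trans (f i e) (cong (_- s) e≡)) (trans d≡ (cong (λ o → + 2 * s - o) e≡)) e≡
        where
        f : ∀ i e → i ≡ e - (e - i)
        f = solve-∀
      -- Positivity of d = 2s - e says 1 + 2k < 2s.
      k<s : k ℕ.< ∣ s ∣
      k<s = ℕ.*-cancelˡ-< 2 k ∣ s ∣ (ℕ.<-trans (ℕ.n<1+n (2 ℕ.* k)) (ℤ.drop‿+<+ (subst₂ _<_ (trans e≡ (odd≡ k)) 2s≡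
        (0<j-i⇒i<j (subst (0ℤ <_) d≡ d>0)))))

  ∑-fibre : ∀ {y s} → 0ℤ < s → ∑ (fibre (y , s)) D ≡ s * s
  ∑-fibre {y} {s} s>0 = begin
    ∑ (fibre (y , s)) D                            ≡⟨ ∑-map (Fibre.point y s) (upTo ∣ s ∣) D ⟩
    ∑ (upTo ∣ s ∣) (λ k → + 2 * s - (1ℤ + + 2 * + k)) ≡⟨ ∑-odds ∣ s ∣ (+ 2 * s) ⟩
    + ∣ s ∣ * (+ 2 * s) - + ∣ s ∣ * + ∣ s ∣        ≡⟨ cong (λ z → z * (+ 2 * s) - z * z) (0<i⇒+∣i∣≡i s>0) ⟩
    s * (+ 2 * s) - s * s                          ≡⟨ e s ⟩
    s * s                                          ∎
    where
    open ≡-Reasoning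
    e : ∀ s → s * (+ 2 * s) - s * s ≡ s * s
    e = solve-∀

  -- As s is positive while y may have either sign, p = a² + b² gives four pairs (y, s), two with s
  -- = b and two with s = a. They contribute 2b² + 2a².
  ∑-diagonal≡2p : ∀ {S₀ a b} → S₀ Lists diag-Sol → a * a + b * b ≡ + p → 0ℤ < a → 0ℤ < b → a ≢ b →
                  ∑ S₀ D ≡ + 2 * + p
  ∑-diagonal≡2p {S₀} {a} {b} S₀-l eq a>0 b>0 a≢b = begin
    ∑ S₀ D
      ≡⟨ ∑-Lists S₀-l (concatMap-Lists Key (λ k₁ k₂ → trans (sym k₁) k₂) js-l key
           (λ {(_ , _)} j∈ → let e , s>0 = js-sound j∈ in fibre-Lists e s>0)) D ⟩
    ∑ (concatMap fibre js) D
      ≡⟨ ∑-concatMap fibre js D ⟩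
    ∑ js (λ j → ∑ (fibre j) D)
      ≡⟨ ∑-cong js {w = λ j → proj₂ j * proj₂ j} (λ {(_ , _)} j∈ → ∑-fibre (proj₂ (js-sound j∈))) ⟩
    b * b + (b * b + (a * a + (a * a + 0ℤ)))
      ≡⟨ f a b ⟩
    + 2 * (a * a + b * b)
      ≡⟨ cong (_*_ (+ 2)) eq ⟩
    + 2 * + p ∎
    where
    open ≡-Reasoning
    f : ∀ a b → b * b + (b * b + (a * a + (a * a + 0ℤ))) ≡ + 2 * (a * a + b * b)
    f = solve-∀
    js : List (ℤ × ℤ)
    js = (a , b) ∷ (- a , b) ∷ (b , a) ∷ (- b , a) ∷ []
    i≢-i : ∀ {i} → 0ℤ < i → i ≢ - i
    i≢-i i>0 i≡-i = ℤ.<⇒≢ i>0 (sym (i≡-i⇒i≡0 i≡-i))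
    js-unique : Unique js
    js-unique = ((i≢-i a>0 ∘ cong proj₁) All.∷ (a≢b ∘ sym ∘ cong proj₂) All.∷ (a≢b ∘ sym ∘ cong proj₂) All.∷ All.[])
              ∷ ((a≢b ∘ sym ∘ cong proj₂) All.∷ (a≢b ∘ sym ∘ cong proj₂) All.∷ All.[])
              ∷ ((i≢-i b>0 ∘ cong proj₁) All.∷ All.[])
              ∷ All.[]
              ∷ []
    js-l : js Lists (_∈ js)
    js-l = record { unique = js-unique ; sound = id ; complete = id }
    neg² : ∀ a b → - a * - a + b * b ≡ a * a + b * b
    neg² = solve-∀
    eq′ : b * b + a * a ≡ + p
    eq′ = trans (ℤ.+-comm (b * b) (a * a)) eq
    js-sound : ∀ {y s} → (y , s) ∈ js → y * y + s * s ≡ + p × 0ℤ < s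
    js-sound (here refl)                         = eq , b>0
    js-sound (there (here refl))                 = trans (neg² a b) eq , b>0
    js-sound (there (there (here refl)))         = eq′ , a>0
    js-sound (there (there (there (here refl)))) = trans (neg² b a) eq′ , a>0
    js-complete : ∀ {y s} → y * y + s * s ≡ + p → 0ℤ < s → (y , s) ∈ js
    js-complete {y} {s} eq₂ s>0 = Sum.[ first , second ]′ (two-squares-unique pp {a} {b} {y} {s} eq eq₂)
      where
      first : y * y ≡ a * a → (y , s) ∈ js
      first y²≡a² = Sum.[ (λ y≡a → here (cong₂ _,_ y≡a s≡b)) , (λ y≡-a → there (here (cong₂ _,_ y≡-a s≡b))) ]′ (squares-eq {y} {a} y²≡a²)
        where
        s≡b : s ≡ b
        s≡b = squares-eq-pos s>0 b>0 (+-cancelˡ-≡ (y * y) (s * s) (b * b) (trans eq₂ (trans (sym eq) (cong (_+ b * b) (sym y²≡a²)))))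
      second : s * s ≡ a * a → (y , s) ∈ js
      second s²≡a² = Sum.[ (λ y≡b → there (there (here (cong₂ _,_ y≡b s≡a))))
                           , (λ y≡-b → there (there (there (here (cong₂ _,_ y≡-b s≡a)))))
                           ]′ (squares-eq {y} {b} y²≡b²)
        where
        s≡a : s ≡ a
        s≡a = squares-eq-pos s>0 a>0 s²≡a²
        y²≡b² : y * y ≡ b * b
        y²≡b² = +-cancelʳ-≡ (s * s) (y * y) (b * b) (trans eq₂ (trans (sym eq′) (cong (_+_ (b * b)) (sym s²≡a²))))
    key : ∀ {t} → diag-Sol t → ∃ λ j → j ∈ js × Key t j
    key {t@(y , i , d , e)} sol = _ , js-complete (diag⇒squares t sol) (diag⇒0<e-i t sol) , refl

  square-mod-4 : ∀ m → (m ℕ.* m) % 4 ≡ 0 ⊎ (m ℕ.* m) % 4 ≡ 1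
  square-mod-4 m = Sum.map (trans (ℕ.%-distribˡ-* m m 4)) (trans (ℕ.%-distribˡ-* m m 4)) (go (m % 4) (ℕ.m%n<n m 4))
    where
    go : ∀ r → r ℕ.< 4 → (r ℕ.* r) % 4 ≡ 0 ⊎ (r ℕ.* r) % 4 ≡ 1
    go 0 _ = inj₁ refl
    go 1 _ = inj₂ refl
    go 2 _ = inj₁ refl
    go 3 _ = inj₂ refl
    go (suc (suc (suc (suc r)))) (ℕ.s≤s (ℕ.s≤s (ℕ.s≤s (ℕ.s≤s ()))))

  no-two-squares : p % 4 ≡ 3 → ∀ i j → i * i + j * j ≢ + p
  no-two-squares p%4≡3 i j eq = go (square-mod-4 ∣ i ∣) (square-mod-4 ∣ j ∣)
    where
    m n : ℕ
    m = ∣ i ∣ ℕ.* ∣ i ∣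
    n = ∣ j ∣ ℕ.* ∣ j ∣
    residues : (m % 4 ℕ.+ n % 4) % 4 ≡ 3
    residues = trans (sym (ℕ.%-distribˡ-+ m n 4)) (trans (cong (_% 4) m+n≡p) p%4≡3)
      where
      m+n≡p : m ℕ.+ n ≡ p
      m+n≡p = ℤ.+-injective (trans (cong₂ _+_ (sym (i*i≡+∣i∣² i)) (sym (i*i≡+∣i∣² j))) eq)
    absurd : ∀ {r s} → m % 4 ≡ r → n % 4 ≡ s → (r ℕ.+ s) % 4 ≢ 3 → ⊥
    absurd r≡ s≡ ≢3 = ≢3 (trans (cong₂ (λ r s → (r ℕ.+ s) % 4) (sym r≡) (sym s≡)) residues)
    go : m % 4 ≡ 0 ⊎ m % 4 ≡ 1 → n % 4 ≡ 0 ⊎ n % 4 ≡ 1 → ⊥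
    go (inj₁ r) (inj₁ s) = absurd r s λ ()
    go (inj₁ r) (inj₂ s) = absurd r s λ ()
    go (inj₂ r) (inj₁ s) = absurd r s λ ()
    go (inj₂ r) (inj₂ s) = absurd r s λ ()

  ∑-diagonal≡0 : ∀ {S₀} → S₀ Lists diag-Sol → p % 4 ≡ 3 → ∑ S₀ D ≡ 0ℤ
  ∑-diagonal≡0 S₀-l p%4≡3 = ∑-none (sound S₀-l) (λ {t} sol → no-two-squares p%4≡3 (proj₁ t) (E t - I t) (diag⇒squares t sol)) D

-- The function σ*

⌊⌋-sound : (a? : Dec A) → ⌊ a? ⌋ ≡ true → A
⌊⌋-sound (yes a) _ = a

⌊⌋-complete : (a? : Dec A) → A → ⌊ a? ⌋ ≡ true
⌊⌋-complete (yes _) _ = refl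
⌊⌋-complete (no ¬a) a = ⊥-elim (¬a a)

isOdd⇒parity : ∀ n → isOdd n ≡ true → parity n ≡ 1ℙ
isOdd⇒parity 1        _   = refl
-- `isOdd (2 + n)` reduces to `isOdd n` by computation.
isOdd⇒parity (ℕ.2+ n) odd = isOdd⇒parity n odd

parity⇒isOdd : ∀ n → parity n ≡ 1ℙ → isOdd n ≡ true
parity⇒isOdd 1        _   = refl
parity⇒isOdd (ℕ.2+ n) odd = parity⇒isOdd n odd

Cofactors : ℕ → ℤ × ℤ → Set
Cofactors m (d , e) = d * e ≡ + m × 0ℤ < d × 0ℤ < e × par e ≡ 1ℙ

-- Repeats the test inside `σ*ℕ`, with divisor `suc k` of `suc m`, so that the two sums agree
-- definitionally.
isTerm : ℕ → ℕ → Bool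
isTerm m k = ⌊ suc k ℕ.∣? suc m ⌋ ∧ isOdd (suc m ℕ./ suc k)

isTerm? : ∀ m → Decidable (λ k → isTerm m k ≡ true)
isTerm? m k = isTerm m k Bool.≟ true

cofactors : ℕ → List (ℤ × ℤ)
cofactors zero    = []
cofactors (suc m) = map (λ k → + suc k , + (suc m ℕ./ suc k)) (filter (isTerm? m) (upTo (suc m)))

0<-* : ∀ {i j} → 0ℤ < i → 0ℤ < j → 0ℤ < i * j
0<-* {+ suc i} {+ suc j} _ _ = ℤ.+<+ ℕ.z<s
0<-* {+ zero} (ℤ.+<+ ()) _
0<-* {+ suc i} {+ zero} _ (ℤ.+<+ ())

cofactors-Lists : ∀ m → cofactors m Lists Cofactors m
cofactors-Lists zero    = record
  { unique   = []
  ; sound    = λ ()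
  ; complete = λ (de≡0 , d>0 , e>0 , _) → ⊥-elim (ℤ.<⇒≢ (0<-* d>0 e>0) (sym de≡0))
  }
cofactors-Lists (suc m) = record
  { unique   = Unique.map⁺ {f = pair} (ℕ.suc-injective ∘ ℤ.+-injective ∘ cong proj₁)
                           (Unique.filter⁺ (isTerm? m) (Unique.upTo⁺ (suc m)))
  ; sound    = λ t∈ → let k , k∈ , t≡ = ∈-map⁻ pair t∈ in
                      subst (Cofactors (suc m)) (sym t≡) (pair-sound k (proj₂ (∈-filter⁻ (isTerm? m) {xs = upTo (suc m)} k∈)))
  ; complete = λ {t} → complete′ t
  }
  where
  pair : ℕ → ℤ × ℤ
  pair k = + suc k , + (suc m ℕ./ suc k)
  odd⇒0< : ∀ n → parity n ≡ 1ℙ → 0ℤ < + n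
  odd⇒0< (suc n) _ = ℤ.+<+ ℕ.z<s
  pair-sound : ∀ k → isTerm m k ≡ true → Cofactors (suc m) (pair k)
  pair-sound k k-term =
    trans (sym (ℤ.pos-* (suc k) (suc m ℕ./ suc k)))
      (cong +_ (ℕ.m*[n/m]≡n (⌊⌋-sound (suc k ℕ.∣? suc m) (Bool.∧-conicalˡ _ _ k-term)))) ,
    ℤ.+<+ ℕ.z<s , odd⇒0< _ odd , odd
    where
    odd : parity (suc m ℕ./ suc k) ≡ 1ℙ
    odd = isOdd⇒parity (suc m ℕ./ suc k) (Bool.∧-conicalʳ ⌊ suc k ℕ.∣? suc m ⌋ _ k-term)
  complete′ : ∀ t → Cofactors (suc m) t → t ∈ cofactors (suc m)
  complete′ (+ suc k , e) (eq , _ , e>0 , e-odd) =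
    subst (_∈ cofactors (suc m)) (cong (+ suc k ,_) (trans (cong +_ quotient) (0<i⇒+∣i∣≡i e>0)))
      (∈-map⁺ pair (∈-filter⁺ (isTerm? m) (∈-upTo⁺ (ℕ.∣⇒≤ divisor)) (cong₂ _∧_ (⌊⌋-complete (suc k ℕ.∣? suc m) divisor)
        (parity⇒isOdd (suc m ℕ./ suc k) (trans (cong parity quotient) e-odd)))))
    where
    product : ∣ e ∣ ℕ.* suc k ≡ suc m
    product = trans (ℕ.*-comm ∣ e ∣ (suc k)) (trans (sym (ℤ.abs-* (+ suc k) e)) (cong ∣_∣ eq))
    divisor : suc k ℕ.∣ suc m
    divisor = divides ∣ e ∣ (sym product)
    quotient : suc m ℕ./ suc k ≡ ∣ e ∣
    quotient = trans (cong (ℕ._/ suc k) (sym product)) (ℕ.m*n/n≡m ∣ e ∣ (suc k))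
  complete′ (+ zero   , e) (_ , ℤ.+<+ () , _)
  complete′ (-[1+ _ ] , e) (_ , () , _)

sum-if : ∀ (b : A → Bool) (f : A → ℕ) xs →
         + sum (map (λ t → if b t then f t else 0) xs) ≡ ∑ (filter (λ t → b t Bool.≟ true) xs) (+_ ∘ f)
sum-if b f []       = refl
sum-if b f (x ∷ xs) with b x
... | true  = trans (ℤ.pos-+ (f x) _) (cong (_+_ (+ f x)) (sum-if b f xs))
... | false = sum-if b f xs

σ*ℕ≡∑ : ∀ m → + σ*ℕ m ≡ ∑ (cofactors m) proj₁
σ*ℕ≡∑ zero    = refl
σ*ℕ≡∑ (suc m) = trans (sum-if (isTerm m) suc (upTo (suc m)))
  (sym (∑-map (λ k → + suc k , + (suc m ℕ./ suc k)) (filter (isTerm? m) (upTo (suc m))) proj₁))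

-- `σ*` inspects the reduced fraction, and coprimality shows that m/1 is already reduced. The same
-- argument keeps the denominator 2 of m/2 for odd m.
σ*-/1 : ∀ m → σ* (+ m ℚ./ 1) ≡ σ*ℕ m
σ*-/1 m = cong σ* (ℚ.normalize-coprime (Coprime.sym (1-coprimeTo m)))

σ*-odd/2 : ∀ m → parity m ≡ 1ℙ → σ* (+ m ℚ./ 2) ≡ 0
σ*-odd/2 m odd = cong σ* (ℚ.normalize-coprime coprime)
  where
  coprime : Coprime m 2
  coprime (i∣m , i∣2) with irreducible[2] i∣2
  ... | inj₁ i≡1  = i≡1
  ... | inj₂ refl with divides q m≡q*2 ← i∣m =
    ⊥-elim (ℙ.p≢p⁻¹ 0ℙ (trans (sym (trans (ℙ.*-homo-* q 2) (ℙ.*-zeroʳ (parity q)))) (trans (cong parity (sym m≡q*2)) odd)))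

σ*-even/2 : ∀ k → σ* (+ (2 ℕ.* k) ℚ./ 2) ≡ σ*ℕ k
-- `mkℚᵘ` stores the denominator minus one, so the fractions compared are 2k/2 and k/1.
σ*-even/2 k = trans (cong σ* (ℚ.fromℚᵘ-cong {mkℚᵘ (+ (2 ℕ.* k)) 1} {mkℚᵘ (+ k) 0} (*≡* (begin
  + (2 ℕ.* k) * 1ℤ   ≡⟨ ℤ.*-identityʳ _ ⟩
  + (2 ℕ.* k)        ≡⟨ cong +_ (ℕ.*-comm 2 k) ⟩
  + (k ℕ.* 2)        ≡⟨ ℤ.pos-* k 2 ⟩
  + k * + 2          ∎)))) (σ*-/1 k)
  where open ≡-Reasoning

even-form : ∀ m → parity m ≡ 0ℙ → ∃ λ k → m ≡ 2 ℕ.* k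
even-form 0        _    = 0 , refl
even-form (ℕ.2+ m) even = let k , eq = even-form m even in
  suc k , cong suc (trans (cong suc eq) (sym (ℕ.+-suc k (k ℕ.+ 0))))

weight : ℤ × ℤ → ℤ
weight (d , _) = sgn (par d) * d

par-cofactor : ∀ m t → Cofactors m t → par (proj₁ t) ≡ parity m
par-cofactor m (d , e) (eq , _ , _ , odd) = begin
  par d              ≡⟨ ℙ.*-identityʳ (par d) ⟨
  par d ℙ.* 1ℙ       ≡⟨ cong (par d ℙ.*_) odd ⟨
  par d ℙ.* par e    ≡⟨ par-* d e ⟨
  par (d * e)        ≡⟨ cong par eq ⟩
  parity m           ∎
  where open ≡-Reasoning

-- If de = 2k with e odd, then d is even and can be halved. Doubling is not onto ℤ, so `map-Lists`
-- does not apply and completeness is shown by this halving.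
∑-double : ∀ k → ∑ (cofactors (2 ℕ.* k)) proj₁ ≡ + 2 * ∑ (cofactors k) proj₁
∑-double k = trans (∑-Lists (cofactors-Lists (2 ℕ.* k)) doubled proj₁) (trans (∑-map double (cofactors k) proj₁) (∑-* (+ 2) (cofactors k) proj₁))
  where
  double : ℤ × ℤ → ℤ × ℤ
  double (d , e) = + 2 * d , e
  double-injective : ∀ {t u} → double t ≡ double u → t ≡ u
  double-injective {t} {u} eq = cong₂ _,_ (ℤ.*-cancelˡ-≡ (+ 2) (proj₁ t) (proj₁ u) (cong proj₁ eq)) (cong proj₂ eq)
  2*>0 : ∀ {i} → 0ℤ < i → 0ℤ < + 2 * i
  2*>0 i>0 = 0<-* {+ 2} (ℤ.+<+ ℕ.z<s) i>0
  double-sound : ∀ t → Cofactors k t → Cofactors (2 ℕ.* k) (double t)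
  double-sound (d , e) (eq , d>0 , e>0 , odd) =
    trans (ℤ.*-assoc (+ 2) d e) (trans (cong (_*_ (+ 2)) eq) (sym (ℤ.pos-* 2 k))) , 2*>0 d>0 , e>0 , odd
  doubled : map double (cofactors k) Lists Cofactors (2 ℕ.* k)
  doubled = record
    { unique   = Unique.map⁺ double-injective (unique (cofactors-Lists k))
    ; sound    = λ t∈ → let s , s∈ , t≡ = ∈-map⁻ double t∈ in
                        subst (Cofactors (2 ℕ.* k)) (sym t≡) (double-sound s (sound (cofactors-Lists k) s∈))
    ; complete = λ {t} → complete′ t
    }
    where
    complete′ : ∀ t → Cofactors (2 ℕ.* k) t → t ∈ map double (cofactors k)
    complete′ (d , e) c@(eq , d>0 , e>0 , odd) with even-form ∣ d ∣ (trans (par-cofactor (2 ℕ.* k) (d , e) c) (ℙ.*-homo-* 2 k))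
    ... | h , ∣d∣≡2h = subst (_∈ map double (cofactors k)) (cong (_, e) (sym d≡2h)) (∈-map⁺ double {x = + h , e} (complete (cofactors-Lists k)
            ( ℤ.*-cancelˡ-≡ (+ 2) (+ h * e) (+ k) (trans (sym (ℤ.*-assoc (+ 2) (+ h) e)) (trans (cong (_* e) (sym d≡2h)) (trans eq (ℤ.pos-* 2 k))))
            , i+i>0⇒i>0 (subst (0ℤ <_) (trans d≡2h (f (+ h))) d>0) , e>0 , odd)))
      where
      d≡2h : d ≡ + 2 * + h
      d≡2h = trans (sym (0<i⇒+∣i∣≡i d>0)) (trans (cong +_ ∣d∣≡2h) (ℤ.pos-* 2 h))
      f : ∀ i → + 2 * i ≡ i + i
      f = solve-∀

-- Since e is odd, d has the parity of m and the sign is constant. For odd m the second term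
-- vanishes. For even m it is 4σ*(m/2) = 2σ*(m), so the factor 4 is what turns σ*(m) into -σ*(m).
∑-weight : ∀ m → + σ* (+ m ℚ./ 1) - + 4 * + σ* (+ m ℚ./ 2) ≡ ∑ (cofactors m) weight
∑-weight m = go (parity m) refl
  where
  open ≡-Reasoning
  weights : ∀ q → parity m ≡ q → ∑ (cofactors m) weight ≡ sgn q * ∑ (cofactors m) proj₁
  weights q m-q = trans (∑-cong (cofactors m) λ {t} t∈ → cong (λ r → sgn r * proj₁ t)
                           (trans (par-cofactor m t (sound (cofactors-Lists m) t∈)) m-q))
                        (∑-* (sgn q) (cofactors m) proj₁)
  go : ∀ q → parity m ≡ q → + σ* (+ m ℚ./ 1) - + 4 * + σ* (+ m ℚ./ 2) ≡ ∑ (cofactors m) weight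
  go 1ℙ odd = begin
    + σ* (+ m ℚ./ 1) - + 4 * + σ* (+ m ℚ./ 2)   ≡⟨ cong₂ (λ x y → + x - + 4 * + y) (σ*-/1 m) (σ*-odd/2 m odd) ⟩
    + σ*ℕ m + 0ℤ                                ≡⟨ ℤ.+-identityʳ (+ σ*ℕ m) ⟩
    + σ*ℕ m                                     ≡⟨ σ*ℕ≡∑ m ⟩
    ∑ (cofactors m) proj₁                       ≡⟨ ℤ.*-identityˡ _ ⟨
    1ℤ * ∑ (cofactors m) proj₁                  ≡⟨ weights 1ℙ odd ⟨
    ∑ (cofactors m) weight                      ∎
  go 0ℙ even with even-form m even
  ... | k , refl = begin
    + σ* (+ m ℚ./ 1) - + 4 * + σ* (+ m ℚ./ 2)   ≡⟨ cong₂ (λ x y → + x - + 4 * + y) (σ*-/1 m) (σ*-even/2 k) ⟩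
    + σ*ℕ m - + 4 * + σ*ℕ k                     ≡⟨ cong₂ (λ x y → x - + 4 * y) (trans (σ*ℕ≡∑ m) (∑-double k)) (σ*ℕ≡∑ k) ⟩
    + 2 * s - + 4 * s                           ≡⟨ f s ⟩
    - 1ℤ * (+ 2 * s)                            ≡⟨ cong (_*_ (- 1ℤ)) (∑-double k) ⟨
    - 1ℤ * ∑ (cofactors m) proj₁                ≡⟨ weights 0ℙ even ⟨
    ∑ (cofactors m) weight                      ∎
    where
    s : ℤ
    s = ∑ (cofactors k) proj₁
    f : ∀ s → + 2 * s - + 4 * s ≡ - 1ℤ * (+ 2 * s)
    f = solve-∀

-- The convolution of r₂ and σ*

squarePairs : ℕ → List (ℤ × ℤ)
squarePairs j = filter (λ t → + j ℤ.≟ sq (proj₁ t) + sq (proj₂ t)) (cartesianProduct (intRange j) (intRange j))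

squarePairs-Lists : ∀ j → squarePairs j Lists (λ (x , y) → + j ≡ x * x + y * y)
squarePairs-Lists j = Lists-resp proj₂ (λ {(x , y)} eq → bounds x y eq , eq)
  (filter-Lists (λ t → + j ℤ.≟ sq (proj₁ t) + sq (proj₂ t)) (×-Lists (intRange-Lists j) (intRange-Lists j)))
  where
  bounds : ∀ x y → + j ≡ x * x + y * y → ∣ x ∣ ℕ.≤ j × ∣ y ∣ ℕ.≤ j
  bounds x y eq =
    ℕ.≤-trans (m≤m*m ∣ x ∣) (ℕ.≤-trans (ℕ.m≤m+n _ (∣ y ∣ ℕ.* ∣ y ∣)) (ℕ.≤-reflexive (sym eq-ℕ))) ,
    ℕ.≤-trans (m≤m*m ∣ y ∣) (ℕ.≤-trans (ℕ.m≤n+m _ (∣ x ∣ ℕ.* ∣ x ∣)) (ℕ.≤-reflexive (sym eq-ℕ)))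
    where
    eq-ℕ : j ≡ ∣ x ∣ ℕ.* ∣ x ∣ ℕ.+ ∣ y ∣ ℕ.* ∣ y ∣
    eq-ℕ = ℤ.+-injective (trans eq (cong₂ _+_ (i*i≡+∣i∣² x) (i*i≡+∣i∣² y)))

count≡length : ∀ (xs : List A) → count xs ≡ + length xs
count≡length []       = refl
count≡length (_ ∷ xs) = cong (_+_ 1ℤ) (count≡length xs)

concatMap≡cartesianProduct : ∀ (xs : List A) (ys : List B) →
  concatMap (λ x → map (x ,_) ys) xs ≡ cartesianProduct xs ys
concatMap≡cartesianProduct []       ys = refl
concatMap≡cartesianProduct (x ∷ xs) ys = cong (_++_ (map (x ,_) ys)) (concatMap≡cartesianProduct xs ys)

r₂≡count : ∀ j → + r₂ j ≡ count (squarePairs j)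
r₂≡count j = trans
  (cong (λ ps → + length (filter (λ t → + j ℤ.≟ sq (proj₁ t) + sq (proj₂ t)) ps))
        (concatMap≡cartesianProduct (intRange j) (intRange j)))
  (sym (count≡length (squarePairs j)))

∑-cartesianProduct : ∀ (xs : List A) (ys : List B) w →
  ∑ (cartesianProduct xs ys) (w ∘ proj₂) ≡ count xs * ∑ ys w
∑-cartesianProduct []       ys w = refl
∑-cartesianProduct (x ∷ xs) ys w = begin
  ∑ (map (x ,_) ys ++ cartesianProduct xs ys) (w ∘ proj₂)
    ≡⟨ ∑-++ (map (x ,_) ys) _ _ ⟩
  ∑ (map (x ,_) ys) (w ∘ proj₂) + ∑ (cartesianProduct xs ys) (w ∘ proj₂)
    ≡⟨ cong₂ _+_ (∑-map (x ,_) ys (w ∘ proj₂)) (∑-cartesianProduct xs ys w) ⟩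
  ∑ ys w + count xs * ∑ ys w
    ≡⟨ f (count xs) (∑ ys w) ⟩
  (1ℤ + count xs) * ∑ ys w ∎
  where
  open ≡-Reasoning
  f : ∀ c s → s + c * s ≡ (1ℤ + c) * s
  f = solve-∀

module Convolution (p : ℕ) where
  open Liouville (+ p)

  -- Written as in the theorem, to agree with it definitionally; it is used at j = 0 as well.
  summand : ℕ → ℤ
  summand j = + r₂ j * (+ σ* (+ (p ∸ j) ℚ./ 1) - + 4 * + σ* (+ (p ∸ j) ℚ./ 2))

  slice : ℕ → List Quad
  slice j = map (λ ((y , i) , (d , e)) → y , i , d , e) (cartesianProduct (squarePairs j) (cofactors (p ∸ j)))

  slice-Lists : ∀ {j} → j ℕ.< p → slice j Lists (λ t → Sol t × (+ j ≡ proj₁ t * proj₁ t + I t * I t))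
  slice-Lists {j} j<p = map-Lists _ (λ (y , i , d , e) → (y , i) , (d , e)) (λ _ → refl) (λ _ → refl) to from
    (×-Lists (squarePairs-Lists j) (cofactors-Lists (p ∸ j)))
    where
    p-j : + p - + j ≡ + (p ∸ j)
    p-j = trans (ℤ.m-n≡m⊖n p j) (ℤ.⊖-≥ (ℕ.<⇒≤ j<p))
    cancel : ∀ i j → i + (j - i) ≡ j
    cancel = solve-∀
    cancel′ : ∀ i j → j ≡ (i + j) - i
    cancel′ = solve-∀
    to : ∀ t → (+ j ≡ proj₁ (proj₁ t) * proj₁ (proj₁ t) + proj₂ (proj₁ t) * proj₂ (proj₁ t)) × Cofactors (p ∸ j) (proj₂ t) → _
    to ((y , i) , (d , e)) (j≡ , de≡ , rest) =
      (trans (cong₂ _+_ (sym j≡) (trans de≡ (sym p-j))) (cancel (+ j) (+ p)) , rest) , j≡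
    from : ∀ t → Sol t × (+ j ≡ proj₁ t * proj₁ t + I t * I t) → _
    from (y , i , d , e) ((eq , rest) , j≡) =
      j≡ , trans (cancel′ (y * y + i * i) (d * e)) (trans (cong₂ _-_ eq (sym j≡)) p-j) , rest

  solutions : List Quad
  solutions = concatMap slice (upTo p)

  -- Solutions are sorted by j = y² + i², which is below p because de is positive.
  solutions-Lists : solutions Lists Sol
  solutions-Lists = concatMap-Lists (λ t j → + j ≡ proj₁ t * proj₁ t + I t * I t)
    (λ eq₁ eq₂ → ℤ.+-injective (trans eq₁ (sym eq₂))) (upTo-Lists p) (λ {t} → key t) slice-Lists
    where
    key : ∀ t → Sol t → ∃ λ j → j ℕ.< p × + j ≡ proj₁ t * proj₁ t + I t * I t
    key (y , i , d , e) (eq , d>0 , e>0 , _) = j , ℤ.drop‿+<+ (0<j-i⇒i<j (subst (0ℤ <_) de≡ (0<-* d>0 e>0))) , j≡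
      where
      j : ℕ
      j = ∣ y ∣ ℕ.* ∣ y ∣ ℕ.+ ∣ i ∣ ℕ.* ∣ i ∣
      j≡ : + j ≡ y * y + i * i
      j≡ = sym (cong₂ _+_ (i*i≡+∣i∣² y) (i*i≡+∣i∣² i))
      f : ∀ i j → j ≡ (i + j) - i
      f = solve-∀
      de≡ : d * e ≡ + p - + j
      de≡ = trans (f (y * y + i * i) (d * e)) (cong₂ _-_ eq (sym j≡))

  ∑-summand : ∑ (upTo p) summand ≡ ∑ solutions (λ t → sgn (par (D t)) * D t)
  ∑-summand = sym (trans (∑-concatMap slice (upTo p) _) (∑-cong (upTo p) (λ {j} _ → ∑-slice j)))
    where
    ∑-slice : ∀ j → ∑ (slice j) (λ t → sgn (par (D t)) * D t) ≡ summand j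
    ∑-slice j = begin
      ∑ (slice j) (λ t → sgn (par (D t)) * D t)
        ≡⟨ ∑-map _ (cartesianProduct (squarePairs j) (cofactors (p ∸ j))) _ ⟩
      ∑ (cartesianProduct (squarePairs j) (cofactors (p ∸ j))) (weight ∘ proj₂)
        ≡⟨ ∑-cartesianProduct (squarePairs j) (cofactors (p ∸ j)) weight ⟩
      count (squarePairs j) * ∑ (cofactors (p ∸ j)) weight
        ≡⟨ cong₂ _*_ (r₂≡count j) (∑-weight (p ∸ j)) ⟨
      summand j ∎
      where open ≡-Reasoning

-- The term at zero and the two residue classes

sumFrom1-upTo : ∀ m f → f 0 + sumFrom1 m f ≡ ∑ (upTo (suc m)) f
sumFrom1-upTo m f = cong (_+_ (f 0)) (trans (sym (∑-map suc (upTo m) f)) (cong (λ ks → ∑ ks f) (map-upTo suc m)))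

∑-weight-prime : ∀ {p} → Prime p → parity p ≡ 1ℙ → ∑ (cofactors p) weight ≡ 1ℤ + + p
∑-weight-prime {p} pp odd = begin
  ∑ (cofactors p) weight                       ≡⟨ ∑-Lists (cofactors-Lists p) pairs weight ⟩
  1ℤ + (sgn (parity p) * + p + 0ℤ)             ≡⟨ cong (λ q → 1ℤ + (sgn q * + p + 0ℤ)) odd ⟩
  1ℤ + (1ℤ * + p + 0ℤ)                         ≡⟨ cong (_+_ 1ℤ) (trans (ℤ.+-identityʳ _) (ℤ.*-identityˡ (+ p))) ⟩
  1ℤ + + p                                     ∎
  where
  open ≡-Reasoning
  instance
    p≢0 : ℕ.NonZero p
    p≢0 = prime⇒nonZero pp
  p>0 : 0ℤ < + p
  p>0 = ℤ.+<+ (ℕ.>-nonZero⁻¹ p)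
  pairs : ((1ℤ , + p) ∷ (+ p , 1ℤ) ∷ []) Lists Cofactors p
  pairs = record
    { unique   = ((λ eq → ¬prime[1] (subst Prime (sym (ℤ.+-injective (cong proj₁ eq))) pp)) All.∷ All.[]) ∷ All.[] ∷ []
    ; sound    = λ { (here refl)         → ℤ.*-identityˡ (+ p) , ℤ.+<+ ℕ.z<s , p>0 , odd
                   ; (there (here refl)) → ℤ.*-identityʳ (+ p) , p>0 , ℤ.+<+ ℕ.z<s , refl }
    ; complete = λ {t} → complete′ t
    }
    where
    complete′ : ∀ t → Cofactors p t → t ∈ (1ℤ , + p) ∷ (+ p , 1ℤ) ∷ []
    complete′ (d , e) (eq , d>0 , e>0 , _) =
      Sum.[ (λ d≡1 → here (cong₂ _,_ (lift d>0 d≡1)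
              (lift e>0 (trans (sym (ℕ.*-identityˡ ∣ e ∣)) (trans (cong (ℕ._* ∣ e ∣) (sym d≡1)) product)))))
          , (λ d≡p → there (here (cong₂ _,_ (lift d>0 d≡p)
              (lift e>0 (ℕ.*-cancelˡ-≡ ∣ e ∣ 1 p (trans (cong (ℕ._* ∣ e ∣) (sym d≡p)) (trans product (sym (ℕ.*-identityʳ p)))))))))
          ]′ (prime⇒irreducible pp (divides ∣ e ∣ (trans (sym product) (ℕ.*-comm ∣ d ∣ ∣ e ∣))))
      where
      product : ∣ d ∣ ℕ.* ∣ e ∣ ≡ p
      product = trans (sym (ℤ.abs-* d e)) (cong ∣_∣ eq)
      lift : ∀ {i n} → 0ℤ < i → ∣ i ∣ ≡ n → i ≡ + n
      lift i>0 ∣i∣≡n = trans (sym (0<i⇒+∣i∣≡i i>0)) (cong +_ ∣i∣≡n)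

mod-4-form : ∀ p {r} → p % 4 ≡ r → p ≡ r ℕ.+ 4 ℕ.* (p ℕ./ 4)
mod-4-form p p%4≡r = trans (ℕ.m≡m%n+[m/n]*n p 4) (cong₂ ℕ._+_ p%4≡r (ℕ.*-comm (p ℕ./ 4) 4))

odd-mod-4 : ∀ p {r} → p % 4 ≡ r → parity r ≡ 1ℙ → parity p ≡ 1ℙ
odd-mod-4 p {r} p%4≡r odd = begin
  parity p                                     ≡⟨ cong parity (mod-4-form p p%4≡r) ⟩
  parity (r ℕ.+ 4 ℕ.* (p ℕ./ 4))               ≡⟨ ℙ.+-homo-+ r (4 ℕ.* (p ℕ./ 4)) ⟩
  parity r ℙ.+ parity (4 ℕ.* (p ℕ./ 4))        ≡⟨ cong₂ ℙ._+_ odd (ℙ.*-homo-* 4 (p ℕ./ 4)) ⟩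
  1ℙ                                           ∎
  where open ≡-Reasoning

-- The residue classes differ only in the sum over the diagonal, which therefore enters as a
-- hypothesis with value `s`. Summation from j = 0 captures all solutions, and the term j = 0 is
-- then subtracted.
convolution : ∀ {p} (pp : Prime p) → parity p ≡ 1ℙ → ∀ {s} →
  (∀ {S₀} → S₀ Lists Diagonal.diag-Sol pp → ∑ S₀ (Liouville.D (+ p)) ≡ s) →
  sumFrom1 (p ∸ 1) (Convolution.summand p) ≡ s - (1ℤ + + p)
convolution {suc m} pp odd {s} diagonal = begin
  sumFrom1 m summand                                   ≡⟨ f (summand 0) (sumFrom1 m summand) ⟩
  (summand 0 + sumFrom1 m summand) - summand 0         ≡⟨ cong₂ _-_ total first ⟩
  s - (1ℤ + + suc m)                                   ∎
  where
  open ≡-Reasoning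
  open Convolution (suc m)
  open Liouville (+ suc m)
  f : ∀ a b → b ≡ (a + b) - a
  f = solve-∀
  total : summand 0 + sumFrom1 m summand ≡ s
  total = trans (sumFrom1-upTo m summand)
    (trans ∑-summand (trans (∑sgn solutions-Lists) (diagonal (S₀-l solutions-Lists))))
  first : summand 0 ≡ 1ℤ + + suc m
  -- `r₂ 0` computes to 1: the origin is the only pair.
  first = trans (ℤ.*-identityˡ _) (trans (∑-weight (suc m)) (∑-weight-prime pp odd))

theorem3p3 : (p : ℕ) → Prime p →
    ((p % 4 ≡ 1) → sumFrom1 (p ∸ 1) (λ j → + r₂ j ℤ.* (+ σ* ((+ (p ∸ j)) ℚ./ 1) ℤ.- + 4 ℤ.* + σ* ((+ (p ∸ j)) ℚ./ 2))) ≡ + (p ∸ 1))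
    × ((p % 4 ≡ 3) → sumFrom1 (p ∸ 1) (λ j → + r₂ j ℤ.* (+ σ* ((+ (p ∸ j)) ℚ./ 1) ℤ.- + 4 ℤ.* + σ* ((+ (p ∸ j)) ℚ./ 2))) ≡ ℤ.- + p ℤ.- + 1)
theorem3p3 p pp = case-1 , case-3
  where
  case-1 : p % 4 ≡ 1 → sumFrom1 (p ∸ 1) (Convolution.summand p) ≡ + (p ∸ 1)
  case-1 p%4≡1 = trans (convolution pp (odd-mod-4 p p%4≡1 refl)
      (λ S₀-l → let _ , _ , eq , a>0 , b>0 , a≢b = squares (p ℕ./ 4) (mod-4-form p p%4≡1) in
                Diagonal.∑-diagonal≡2p pp S₀-l eq a>0 b>0 a≢b))
    (2p-p-1 p {{prime⇒nonZero pp}})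
    where
    squares : ∀ k → p ≡ 1 ℕ.+ 4 ℕ.* k → ∃ λ a → ∃ λ b → a * a + b * b ≡ + p × 0ℤ < a × 0ℤ < b × a ≢ b
    -- Heath-Brown's triple (k, 1, 1) must have a positive first entry; k = 0 would mean p = 1.
    squares zero    p≡1    = ⊥-elim (¬prime[1] (subst Prime p≡1 pp))
    squares (suc k) p≡1+4k = HeathBrown.two-squares pp p≡1+4k
    f : ∀ m → + 2 * (1ℤ + m) - (1ℤ + (1ℤ + m)) ≡ m
    f = solve-∀
    2p-p-1 : ∀ p .{{_ : ℕ.NonZero p}} → + 2 * + p - (1ℤ + + p) ≡ + (p ∸ 1)
    2p-p-1 (suc m) = f (+ m)
  case-3 : p % 4 ≡ 3 → sumFrom1 (p ∸ 1) (Convolution.summand p) ≡ - + p - + 1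
  case-3 p%4≡3 = trans (convolution pp (odd-mod-4 p p%4≡3 refl) (λ S₀-l → Diagonal.∑-diagonal≡0 pp S₀-l p%4≡3)) (f (+ p))
    where
    f : ∀ p → 0ℤ - (1ℤ + p) ≡ - p - 1ℤ
    f = solve-∀
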